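{- For each pca $\mathcal{A}$ let $Eq$ be the function on $\mathcal{A}$ deciding equality: $Eq([a,b])=\mathsf{T}$ if $a=b$ and $\mathsf{F}$ otherwise. There is no decidable applicative morphism from any of the pcas $\mathcal{P}(\mathbb{N})[Eq]$, $\mathcal{K}_2[Eq]$, $2^\omega[Eq]$ into any of the pcas $\mathcal{P}(\mathbb{N})$, $\mathcal{K}_2$, $2^\omega$.
   Context: A partial combinatory algebra (pca) is a set $\mathcal{A}$ with a partial binary application $(a,b)\mapsto ab$ (associating to the left) such that there are $\mathsf{k},\mathsf{s}\in\mathcal{A}$ with, for all $a,b,c$: $\mathsf{k}ab=a$; $\mathsf{s}ab$ is defined; and whenever $(ac)(bc)$ is defined, $\mathsf{s}abc$ is defined and equals $(ac)(bc)$. Every pca contains booleans $\mathsf{T},\mathsf{F}$ with a definition-by-cases element $D$ ($D\mathsf{T}ab=a$, $D\mathsf{F}ab=b$), and standard codings $[a,b]$ of pairs and $[a_0,\ldots,a_{n-1}]$ of finite sequences whose basic operations (length, projections, appending) are representable by elements of the pca; fix such choices. For a pca $\mathcal{A}$ and a partial function $f:\mathcal{A}\to\mathcal{A}$, $\mathcal{A}[f]$ is the pca with underlying set $\mathcal{A}$ and application $\cdot_f$ defined by: $a\cdot_f b=c$ iff there is a finite sequence $e_0,\ldots,e_{n-1}$ in $\mathcal{A}$ (on each of which $f$ is defined) such that $a[b,f(e_0),\ldots,f(e_{i-1})]=[\mathsf{F},e_i]$ for all $i<n$ and $a[b,f(e_0),\ldots,f(e_{n-1})]=[\mathsf{T},c]$.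 (The function $f$ is representable in $\mathcal{A}[f]$, and so is the application of $\mathcal{A}$.) An applicative morphism $\gamma:\mathcal{A}\to\mathcal{B}$ assigns to every $a\in\mathcal{A}$ a nonempty subset $\gamma(a)\subseteq\mathcal{B}$ such that there is $r\in\mathcal{B}$ with: whenever $aa'$ is defined, $b\in\gamma(a)$, $b'\in\gamma(a')$, then $rbb'$ is defined and lies in $\gamma(aa')$. It is decidable if there is $d\in\mathcal{B}$ with $db=\mathsf{T}_{\mathcal{B}}$ for all $b\in\gamma(\mathsf{T}_{\mathcal{A}})$ and $dc=\mathsf{F}_{\mathcal{B}}$ for all $c\in\gamma(\mathsf{F}_{\mathcal{A}})$. The pcas: $[\cdot,\cdot]$ on $\mathbb{N}$ is a standard bijective pairing and $[\cdot,\ldots,\cdot]$ a standard coding of finite sequences of naturals. - $\mathcal{P}(\mathbb{N})$ (Scott's graph model): subsets of $\mathbb{N}$ with $A\circ B=\{n\mid\exists m\,([m,n]\in A,\ e_m\subseteq B)\}$, where $e_k$ is the finite set $p$ with $k=\sum_{i\in p}2^i$. - $\mathcal{K}_2$: set $\mathbb{N}^{\mathbb{N}}$; $\alpha\beta$ is defined iff for every $n$ there is $k$ with $\alpha([n,\beta(0),\ldots,\beta(k-1)])>0$, and then $(\alpha\beta)(n)=\alpha([n,\beta(0),\ldots,\beta(k-1)])-1$ for the least such $k$. - $2^\omega$: set $\{0,1\}^{\mathbb{N}}$; $\alpha\cdot\beta$ is defined iff for every $n$ there is $k$ with $\alpha([n,\beta(0),\ldots,\beta(k-1)])=1$, and then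 $(\alpha\cdot\beta)(n)=\alpha([n,\beta(0),\ldots,\beta(k)])$ for the least such $k$. -}

module Defs where

open import Level using (Level; _⊔_; 0ℓ) renaming (suc to lsuc)
open import Data.Fin using (Fin; toℕ)
open import Data.Fin.Patterns using (0F; 1F)
open import Data.List
  using (List; []; _∷_; _++_; _∷ʳ_; length; lookup; applyUpTo; map; take; deduplicate)
open import Data.List.Membership.Propositional using (_∈_)
open import Data.List.Membership.Propositional.Properties
  using (∈-++⁺ˡ; ∈-++⁺ʳ; ∈-++⁻; ∈-deduplicate⁺; ∈-deduplicate⁻)
open import Data.List.Properties using (length-applyUpTo; length-take)
open import Data.List.Relation.Binary.Pointwise using (Pointwise; []; _∷_)
open import Data.List.Relation.Unary.All using (All; []; _∷_) renaming (lookup to All-lookup)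
open import Data.List.Relation.Unary.AllPairs using ([]; _∷_)
open import Data.List.Relation.Unary.Any using (here; there)
open import Data.List.Relation.Unary.Unique.Propositional using (Unique)
open import Data.List.Relation.Unary.Unique.Propositional.Properties using (map⁺)
open import Data.List.Relation.Unary.Unique.DecPropositional.Properties using (deduplicate-!)
open import Data.Maybe using (Maybe; just; nothing; _>>=_; fromMaybe)
open import Data.Maybe.Properties using (just-injective)
open import Data.Nat
  using (ℕ; zero; suc; _+_; _^_; _≤_; _<_; z≤n; s≤s; _≟_; _≤?_) renaming (_⊔_ to max)
open import Data.Nat.ListAction using (sum)
open import Data.Nat.Induction using (<-rec)
open import Data.Nat.Properties
open import Data.List.Membership.DecPropositional _≟_ using (_∈?_)
open import Data.Product using (∃; ∃₂; _×_; _,_; proj₁; proj₂)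
open import Data.Sum using (_⊎_; inj₁; inj₂)
open import Function using (_∘_; id)
open import Relation.Binary using (Setoid; tri<; tri≈; tri>)
open import Relation.Binary.PropositionalEquality
  using (_≡_; _≢_; _≗_; refl; sym; trans; cong; cong₂; subst; _→-setoid_)
open import Relation.Nullary using (¬_; yes; no; contradiction)
open import Relation.Unary using (Pred; _⊆_; _≐_)
open import Relation.Unary.Relation.Binary.Equality using (≐-setoid)

-- Sets are rendered as setoids (so that subsets of ℕ and functions on ℕ
-- are compared extensionally) and a partial binary operation as a
-- functional ternary relation: a · b ↦ c means "ab is defined and ab = c".

record PAS (c e p : Level) : Set (lsuc (c ⊔ e ⊔ p)) where
  field
    setoid : Setoid c e
  open Setoid setoid public
    using (Carrier; _≈_)
    renaming (refl to ≈-refl; sym to ≈-sym; trans to ≈-trans)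
  infix 4 _·_↦_
  field
    _·_↦_ : Carrier → Carrier → Carrier → Set p
    ·-resp : ∀ {a a′ b b′ c c′} → a ≈ a′ → b ≈ b′ → c ≈ c′ →
             a · b ↦ c → a′ · b′ ↦ c′
    ·-functional : ∀ {a b c c′} → a · b ↦ c → a · b ↦ c′ → c ≈ c′

infixl 7 _∙_
infix 8 `_

data Term {c} (A : Set c) : Set c where
  `_  : A → Term A
  _∙_ : Term A → Term A → Term A

-- t ⇓ v: the closed term t is defined and its value is v.

module Evaluation {c e p} (A : PAS c e p) where
  open PAS A

  infix 4 _⇓_
  data _⇓_ : Term Carrier → Carrier → Set (c ⊔ e ⊔ p) where
    val : ∀ {a v} → a ≈ v → ` a ⇓ v
    app : ∀ {t u x y v} → t ⇓ x → u ⇓ y → x · y ↦ v → t ∙ u ⇓ v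

  ⇓-functional : ∀ {t v w} → t ⇓ v → t ⇓ w → v ≈ w
  ⇓-functional (val q) (val r) = ≈-trans (≈-sym q) r
  ⇓-functional (app d₁ d₂ q) (app d₃ d₄ r) =
    ·-functional (·-resp (⇓-functional d₁ d₃) (⇓-functional d₂ d₄) ≈-refl q) r

  ⇓-resp : ∀ {t v w} → v ≈ w → t ⇓ v → t ⇓ w
  ⇓-resp h (val q)       = val (≈-trans q h)
  ⇓-resp h (app d₁ d₂ q) = app d₁ d₂ (·-resp ≈-refl ≈-refl h q)

record PCA (c e p : Level) : Set (lsuc (c ⊔ e ⊔ p)) where
  field
    pas : PAS c e p
  open PAS pas public
  open Evaluation pas public
  field
    k s   : Carrier
    k-law : ∀ a b → ` k ∙ ` a ∙ ` b ⇓ a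
    s-def : ∀ a b → ∃ λ c → ` s ∙ ` a ∙ ` b ⇓ c
    s-law : ∀ a b c {d} → (` a ∙ ` c) ∙ (` b ∙ ` c) ⇓ d → ` s ∙ ` a ∙ ` b ∙ ` c ⇓ d

-- Booleans with definition by cases, and codings of pairs and finite
-- sequences, are arbitrary choices satisfying the following
-- specifications.  The index of a projection and the length of a sequence
-- are passed through an arbitrary representation of the natural numbers.

record Booleans {c e p} (A : PAS c e p) : Set (c ⊔ e ⊔ p) where
  open PAS A
  open Evaluation A
  field
    T F D : Carrier
    D-T   : ∀ a b → ` D ∙ ` T ∙ ` a ∙ ` b ⇓ a
    D-F   : ∀ a b → ` D ∙ ` F ∙ ` a ∙ ` b ⇓ b

record Codings {c e p} (A : PAS c e p) : Set (c ⊔ e ⊔ p) where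
  open PAS A
  open Evaluation A
  field
    booleans : Booleans A
  open Booleans booleans public
  field
    pair          : Carrier → Carrier → Carrier
    pair-cong     : ∀ {a a′ b b′} → a ≈ a′ → b ≈ b′ → pair a b ≈ pair a′ b′
    pairing π₁ π₂ : Carrier
    pairing-law   : ∀ a b → ` pairing ∙ ` a ∙ ` b ⇓ pair a b
    π₁-law        : ∀ a b → ` π₁ ∙ ` pair a b ⇓ a
    π₂-law        : ∀ a b → ` π₂ ∙ ` pair a b ⇓ b

    num                  : ℕ → Carrier
    succ pred isZero     : Carrier
    succ-law             : ∀ n → ` succ ∙ ` num n ⇓ num (suc n)
    pred-law             : ∀ n → ` pred ∙ ` num (suc n) ⇓ num n
    isZero-zero          : ` isZero ∙ ` num 0 ⇓ T
    isZero-suc           : ∀ n → ` isZero ∙ ` num (suc n) ⇓ F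

    seq                  : List Carrier → Carrier
    seq-cong             : ∀ {u v} → Pointwise _≈_ u v → seq u ≈ seq v
    len proj append      : Carrier
    len-law              : ∀ u → ` len ∙ ` seq u ⇓ num (length u)
    proj-law             : ∀ u i → ` proj ∙ ` num (toℕ i) ∙ ` seq u ⇓ lookup u i
    append-law           : ∀ u a → ` append ∙ ` seq u ∙ ` a ⇓ seq (u ∷ʳ a)

  pair-injective : ∀ {a a′ b b′} → pair a b ≈ pair a′ b′ → a ≈ a′ × b ≈ b′
  pair-injective {a} {a′} {b} {b′} h =
    ⇓-functional (π₁-law a b) (move (π₁-law a′ b′)) ,
    ⇓-functional (π₂-law a b) (move (π₂-law a′ b′))
    where
    move : ∀ {q v} → ` q ∙ ` pair a′ b′ ⇓ v → ` q ∙ ` pair a b ⇓ v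
    move (app d (val r) t) = app d (val (≈-trans h r)) t

  T≈F⇒trivial : T ≈ F → ∀ a b → a ≈ b
  T≈F⇒trivial h a b = ⇓-functional (D-T a b) (move (D-F a b))
    where
    move : ∀ {v} → ` D ∙ ` F ∙ ` a ∙ ` b ⇓ v → ` D ∙ ` T ∙ ` a ∙ ` b ⇓ v
    move (app (app (app d (val r) q₁) d₂ q₂) d₃ q₃) =
      app (app (app d (val (≈-trans h r)) q₁) d₂ q₂) d₃ q₃

record PartialFunction {c e p} (A : PAS c e p) (g : Level) : Set (c ⊔ e ⊔ lsuc g) where
  open PAS A
  field
    Graph      : Carrier → Carrier → Set g
    resp       : ∀ {a a′ b b′} → a ≈ a′ → b ≈ b′ → Graph a b → Graph a′ b′
    functional : ∀ {a b b′} → Graph a b → Graph a b′ → b ≈ b′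

module _ {c e p g} (A : PAS c e p) (C : Codings A) (f : PartialFunction A g) where
  open PAS A
  open Evaluation A
  open Codings C
  open PartialFunction f

  -- Only x 0, …, x (n - 1) and their images v 0, …, v (n - 1) under f matter;
  -- applyUpTo v i is the list of f(x₀), …, f(xᵢ₋₁).

  Computes : Carrier → Carrier → Carrier → Set (c ⊔ e ⊔ p ⊔ g)
  Computes a b d = ∃ λ n → ∃₂ λ (x v : ℕ → Carrier) →
    (∀ {i} → i < n → Graph (x i) (v i)) ×
    (∀ {i} → i < n → ` a ∙ ` seq (b ∷ applyUpTo v i) ⇓ pair F (x i)) ×
    (` a ∙ ` seq (b ∷ applyUpTo v n) ⇓ pair T d)

  private
    applyUpTo-≈ : ∀ (v w : ℕ → Carrier) i → (∀ {j} → j < i → v j ≈ w j) →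
                  Pointwise _≈_ (applyUpTo v i) (applyUpTo w i)
    applyUpTo-≈ v w zero    h = []
    applyUpTo-≈ v w (suc i) h = h (s≤s z≤n) ∷ applyUpTo-≈ (v ∘ suc) (w ∘ suc) i (h ∘ s≤s)

    ≈-refls : ∀ u → Pointwise _≈_ u u
    ≈-refls []      = []
    ≈-refls (_ ∷ u) = ≈-refl ∷ ≈-refls u

    move : ∀ {a a′ y y′ z} → a ≈ a′ → y ≈ y′ → ` a ∙ ` y ⇓ z → ` a′ ∙ ` y′ ⇓ z
    move ha hy (app (val q) (val r) t) =
      app (val (≈-trans (≈-sym ha) q)) (val (≈-trans (≈-sym hy) r)) t

    computes-resp : ∀ {a a′ b b′ d d′} → a ≈ a′ → b ≈ b′ → d ≈ d′ →
                    Computes a b d → Computes a′ b′ d′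
    computes-resp ha hb hd (n , x , v , dom , ask , ret) =
      n , x , v , dom ,
      (λ i<n → move ha (seq-cong (hb ∷ ≈-refls _)) (ask i<n)) ,
      ⇓-resp (pair-cong ≈-refl hd) (move ha (seq-cong (hb ∷ ≈-refls _)) ret)

    computes-functional : ∀ {a b d d′} → Computes a b d → Computes a b d′ → d ≈ d′
    computes-functional {a} {b} {d} {d′}
      (n , x , v , dom , ask , ret) (n′ , x′ , v′ , dom′ , ask′ , ret′) = answer
      where
      agree : ∀ i → i ≤ n → i ≤ n′ → ∀ {j} → j < i → v j ≈ v′ j

      meet : ∀ i → i ≤ n → i ≤ n′ → ∀ {y z} → ` a ∙ ` seq (b ∷ applyUpTo v i) ⇓ y →
             ` a ∙ ` seq (b ∷ applyUpTo v′ i) ⇓ z → y ≈ z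
      meet i l l′ q r = ⇓-functional
        (move ≈-refl (seq-cong (≈-refl ∷ applyUpTo-≈ v v′ i (agree i l l′))) q) r

      agree (suc i) l l′ (s≤s j≤i) with m≤n⇒m<n∨m≡n j≤i
      ... | inj₁ j<i  = agree i (<⇒≤ l) (<⇒≤ l′) j<i
      ... | inj₂ refl = functional
        (resp (proj₂ (pair-injective (meet i (<⇒≤ l) (<⇒≤ l′) (ask l) (ask′ l′)))) ≈-refl (dom l))
        (dom′ l′)

      answer : d ≈ d′
      answer with <-cmp n n′
      ... | tri< l _ _ = T≈F⇒trivial
        (proj₁ (pair-injective (meet n ≤-refl (<⇒≤ l) ret (ask′ l)))) d d′
      ... | tri≈ _ refl _ = proj₂ (pair-injective (meet n ≤-refl ≤-refl ret ret′))
      ... | tri> _ _ l = T≈F⇒trivial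
        (≈-sym (proj₁ (pair-injective (meet n′ (<⇒≤ l) ≤-refl (ask l) ret′)))) d d′

  adjoin : PAS c e (c ⊔ e ⊔ p ⊔ g)
  adjoin = record
    { setoid       = setoid
    ; _·_↦_        = Computes
    ; ·-resp       = computes-resp
    ; ·-functional = computes-functional
    }

module _ {c e p} (A : PAS c e p) (C : Codings A) where
  open PAS A
  open Codings C

  -- Defined exactly on the elements of the form [a , b].

  Eq : PartialFunction A (c ⊔ e)
  Eq = record
    { Graph      = λ x y → ∃₂ λ a b → x ≈ pair a b × (a ≈ b × y ≈ T ⊎ ¬ a ≈ b × y ≈ F)
    ; resp       = λ hx hy (a , b , h , v) → a , b , ≈-trans (≈-sym hx) h , resp-value hy v
    ; functional = λ (_ , _ , h , v) (_ , _ , h′ , v′) →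
        let ha , hb = pair-injective (≈-trans (≈-sym h) h′) in functional-value ha hb v v′
    }
    where
    Value : Carrier → Carrier → Carrier → Set e
    Value a b y = a ≈ b × y ≈ T ⊎ ¬ a ≈ b × y ≈ F

    resp-value : ∀ {a b y y′} → y ≈ y′ → Value a b y → Value a b y′
    resp-value h (inj₁ (q , r)) = inj₁ (q , ≈-trans (≈-sym h) r)
    resp-value h (inj₂ (q , r)) = inj₂ (q , ≈-trans (≈-sym h) r)

    functional-value : ∀ {a a′ b b′ y y′} → a ≈ a′ → b ≈ b′ → Value a b y → Value a′ b′ y′ → y ≈ y′
    functional-value ha hb (inj₁ (_ , r)) (inj₁ (_ , r′)) = ≈-trans r (≈-sym r′)
    functional-value ha hb (inj₁ (q , _)) (inj₂ (q′ , _)) =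
      contradiction (≈-trans (≈-sym ha) (≈-trans q hb)) q′
    functional-value ha hb (inj₂ (q , _)) (inj₁ (q′ , _)) =
      contradiction (≈-trans ha (≈-trans q′ (≈-sym hb))) q
    functional-value ha hb (inj₂ (_ , r)) (inj₂ (_ , r′)) = ≈-trans r (≈-sym r′)

_[Eq]_ : ∀ {c e p} (A : PAS c e p) → Codings A → PAS c e (c ⊔ e ⊔ p)
A [Eq] C = adjoin A C (Eq A C)

record ApplicativeMorphism {c e p c′ e′ p′} (A : PAS c e p) (B : PAS c′ e′ p′) (ℓ : Level)
       : Set (c ⊔ e ⊔ p ⊔ c′ ⊔ e′ ⊔ p′ ⊔ lsuc ℓ) where
  private
    module A = PAS A
    module B = PAS B
  open Evaluation B using (_⇓_)
  field
    γ        : A.Carrier → Pred B.Carrier ℓ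
    γ-resp   : ∀ {a a′ b b′} → a A.≈ a′ → b B.≈ b′ → γ a b → γ a′ b′
    nonempty : ∀ a → ∃ (γ a)
    r        : B.Carrier
    r-law    : ∀ {a a′ a″ b b′} → a A.· a′ ↦ a″ → γ a b → γ a′ b′ →
               ∃ λ b″ → (` r ∙ ` b ∙ ` b′ ⇓ b″) × γ a″ b″

module _ {c e p c′ e′ p′ ℓ : Level} {A : PAS c e p} {B : PAS c′ e′ p′} where

  IsDecidable : Booleans A → Booleans B → ApplicativeMorphism A B ℓ → Set (c′ ⊔ e′ ⊔ p′ ⊔ ℓ)
  IsDecidable bA bB M = ∃ λ d →
    (∀ {b} → γ (T bA) b → ` d ∙ ` b ⇓ T bB) × (∀ {b} → γ (F bA) b → ` d ∙ ` b ⇓ F bB)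
    where
    open ApplicativeMorphism M
    open Evaluation B using (_⇓_)
    open Booleans using (T; F)

-- Cantor's pairing; unpair enumerates ℕ × ℕ along antidiagonals.

triangle : ℕ → ℕ
triangle zero    = 0
triangle (suc n) = suc n + triangle n

⟨_,_⟩ : ℕ → ℕ → ℕ
⟨ m , n ⟩ = triangle (m + n) + n

unpair : ℕ → ℕ × ℕ
unpair zero    = 0 , 0
unpair (suc i) with unpair i
... | zero  , n = suc n , 0
... | suc m , n = m , suc n

private
  next : ℕ × ℕ → ℕ × ℕ
  next (zero  , n) = suc n , 0
  next (suc m , n) = m , suc n

  unpair-suc : ∀ i → unpair (suc i) ≡ next (unpair i)
  unpair-suc i with unpair i
  ... | zero  , n = refl
  ... | suc m , n = refl

  unpair-pair′ : ∀ t m n → m + n ≡ t → unpair ⟨ m , n ⟩ ≡ (m , n)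
  unpair-pair′ t m (suc n) h = trans (cong unpair same)
    (trans (unpair-suc ⟨ suc m , n ⟩)
           (cong next (unpair-pair′ t (suc m) n (trans (sym (+-suc m n)) h))))
    where
    same : ⟨ m , suc n ⟩ ≡ suc ⟨ suc m , n ⟩
    same = trans (cong (λ x → triangle x + suc n) (+-suc m n)) (+-suc (triangle (suc m + n)) n)
  unpair-pair′ t zero zero h = refl
  unpair-pair′ (suc t) (suc m) zero h = trans (cong unpair same)
    (trans (unpair-suc ⟨ 0 , m ⟩)
           (cong next (unpair-pair′ t 0 m (trans (sym (+-identityʳ m)) (suc-injective h)))))
    where
    same : ⟨ suc m , 0 ⟩ ≡ suc ⟨ 0 , m ⟩
    same = trans (+-identityʳ _) (trans (cong (λ x → suc (x + triangle x)) (+-identityʳ m))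
      (cong suc (+-comm m (triangle m))))

unpair-pair : ∀ m n → unpair ⟨ m , n ⟩ ≡ (m , n)
unpair-pair m n = unpair-pair′ (m + n) m n refl

pair-unpair : ∀ i → ⟨ proj₁ (unpair i) , proj₂ (unpair i) ⟩ ≡ i
pair-unpair zero    = refl
pair-unpair (suc i) with unpair i | pair-unpair i
... | zero  , n | h = trans (+-identityʳ _) (trans (cong (λ x → suc (x + triangle x)) (+-identityʳ n))
      (cong suc (trans (+-comm n (triangle n)) h)))
... | suc m , n | h = trans (cong (λ x → triangle x + suc n) (+-suc m n))
      (trans (+-suc (triangle (suc m + n)) n) (cong suc h))

code : List ℕ → ℕ
code []      = 0
code (n ∷ u) = suc ⟨ n , code u ⟩

private
  decode′ : ℕ → ℕ → List ℕ
  decode′ zero    _       = []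
  decode′ (suc _) zero    = []
  decode′ (suc f) (suc i) = proj₁ (unpair i) ∷ decode′ f (proj₂ (unpair i))

decode : ℕ → List ℕ
decode i = decode′ i i

private
  n≤triangle : ∀ n → n ≤ triangle n
  n≤triangle zero    = z≤n
  n≤triangle (suc n) = m≤m+n (suc n) (triangle n)

  m≤pair : ∀ m n → m ≤ ⟨ m , n ⟩
  m≤pair m n = ≤-trans (m≤m+n m n) (≤-trans (n≤triangle (m + n)) (m≤m+n _ n))

  decode-code′ : ∀ f u → code u ≤ f → decode′ f (code u) ≡ u
  decode-code′ zero    []      h = refl
  decode-code′ (suc f) []      h = refl
  decode-code′ (suc f) (n ∷ u) (s≤s h) rewrite unpair-pair n (code u) =
    cong (n ∷_) (decode-code′ f u (≤-trans (m≤n+m (code u) _) h))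

  decode-length′ : ∀ f i → length (decode′ f i) ≤ f
  decode-length′ zero    i       = z≤n
  decode-length′ (suc f) zero    = z≤n
  decode-length′ (suc f) (suc i) = s≤s (decode-length′ f _)

decode-code : ∀ u → decode (code u) ≡ u
decode-code u = decode-code′ (code u) u ≤-refl

private
  decode-bounds : ∀ {i n u} → decode i ≡ n ∷ u → n < i × length u < i
  decode-bounds {suc i} refl =
    s≤s (≤-trans (m≤pair _ (proj₂ (unpair i))) (≤-reflexive (pair-unpair i))) ,
    s≤s (decode-length′ i (proj₂ (unpair i)))

-- 𝒦₂ and 2^ω have a common shape: elements are functions ℕ → X, and
-- (α β)(n) is read off from the answers α([n , β(0) , … , β(k - 1)]),
-- k = 0, 1, …, according to a protocol Out (Out q y: the answers q yield y).
-- `out` runs the protocol for a bounded time on partially known answers, and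
-- `emit` produces answers from which a value obtained at some stage is read.

private
  Eventually : (ℕ → Set) → Set
  Eventually P = ∃ λ N₀ → ∀ {N} → N₀ ≤ N → P N

  eventually₂ : ∀ {P Q R : ℕ → Set} → (∀ {N} → P N → Q N → R N) →
                Eventually P → Eventually Q → Eventually R
  eventually₂ f (N₀ , h) (N₁ , h′) =
    max N₀ N₁ , λ l → f (h (≤-trans (m≤m⊔n N₀ N₁) l)) (h′ (≤-trans (m≤n⊔m N₀ N₁) l))

  eventually-all : ∀ {P : ℕ → ℕ → Set} → (∀ j → Eventually (P j)) →
                   ∀ k → Eventually (λ N → ∀ {j} → j ≤ k → P j N)
  eventually-all h zero = proj₁ (h 0) , λ { l z≤n → proj₂ (h 0) l }
  eventually-all {P} h (suc k) = eventually₂ both (eventually-all h k) (h (suc k))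
    where
    both : ∀ {N} → (∀ {j} → j ≤ k → P j N) → P (suc k) N → ∀ {j} → j ≤ suc k → P j N
    both p q l with m≤n⇒m<n∨m≡n l
    ... | inj₁ (s≤s l′) = p l′
    ... | inj₂ refl     = q

  applyUpTo-cong : ∀ {A : Set} {f g : ℕ → A} k → (∀ {i} → i < k → f i ≡ g i) →
                   applyUpTo f k ≡ applyUpTo g k
  applyUpTo-cong zero    h = refl
  applyUpTo-cong (suc k) h = cong₂ _∷_ (h (s≤s z≤n)) (applyUpTo-cong k (h ∘ s≤s))

  take-applyUpTo : ∀ {A : Set} (f : ℕ → A) {j k} → j ≤ k → take j (applyUpTo f k) ≡ applyUpTo f j
  take-applyUpTo f z≤n     = refl
  take-applyUpTo f (s≤s l) = cong (f 0 ∷_) (take-applyUpTo (f ∘ suc) l)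

record Protocol (X : Set) : Set₁ where
  field
    emb            : X → ℕ
    prj            : ℕ → X
    prj-emb        : ∀ x → prj (emb x) ≡ x
    Out            : (ℕ → X) → X → Set
    Out-resp       : ∀ {q q′ y} → q ≗ q′ → Out q y → Out q′ y
    Out-functional : ∀ {q y y′} → Out q y → Out q y′ → y ≡ y′
    out            : ℕ → (ℕ → Maybe X) → Maybe X
    out-sound      : ∀ N {q′ q y v} → (∀ k {x} → q′ k ≡ just x → x ≡ q k) →
                     Out q y → out N q′ ≡ just v → v ≡ y
    out-complete   : ∀ {q′ : ℕ → ℕ → Maybe X} {q y} →
                     (∀ k → Eventually λ N → q′ N k ≡ just (q k)) →
                     Out q y → Eventually λ N → out N (q′ N) ≡ just y
    emit           : (ℕ → Maybe X) → ℕ → X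
    emit-cong      : ∀ {g g′} k → (∀ {j} → j ≤ k → g j ≡ g′ j) → emit g k ≡ emit g′ k
    emit-out       : ∀ {g y} → (∀ j {v} → g j ≡ just v → v ≡ y) →
                     (∃ λ j → g j ≡ just y) → Out (emit g) y

module FunctionModel {X : Set} (P : Protocol X) where
  open Protocol P

  infix 8 _↾_
  _↾_ : (ℕ → X) → ℕ → List ℕ
  β ↾ k = applyUpTo (emb ∘ β) k

  App : (ℕ → X) → (ℕ → X) → (ℕ → X) → Set
  App α β δ = ∀ n → Out (λ k → α (code (n ∷ β ↾ k))) (δ n)

  pas : PAS 0ℓ 0ℓ 0ℓ
  pas = record
    { setoid       = ℕ →-setoid X
    ; _·_↦_        = App
    ; ·-resp       = λ {α} {α′} ha hb hc h n → subst (Out _) (hc n) (Out-resp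
        (λ k → trans (ha _) (cong (λ w → α′ (code (n ∷ w))) (applyUpTo-cong k (λ _ → cong emb (hb _)))))
        (h n))
    ; ·-functional = λ h h′ n → Out-functional (h n) (h′ n)
    }

  private
    rep′ : (ℕ → List ℕ → Maybe X) → List ℕ → X
    rep′ H []      = prj 0
    rep′ H (n ∷ u) = emit (λ j → H n (take j u)) (length u)

    rep : (ℕ → List ℕ → Maybe X) → ℕ → X
    rep H m = rep′ H (decode m)

    rep-app : ∀ H {β δ} → (∀ n j {v} → H n (β ↾ j) ≡ just v → v ≡ δ n) →
              (∀ n → ∃ λ j → H n (β ↾ j) ≡ just (δ n)) → App (rep H) β δ
    rep-app H {β} {δ} sound complete n = Out-resp same (emit-out (sound n) (complete n))
      where
      same : ∀ k → emit (λ j → H n (β ↾ j)) k ≡ rep H (code (n ∷ β ↾ k))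
      same k = sym (trans (cong (rep′ H) (decode-code (n ∷ β ↾ k)))
        (trans (cong (emit _) (length-applyUpTo (emb ∘ β) k))
               (emit-cong k (λ l → cong (H n) (take-applyUpTo (emb ∘ β) l)))))

    rep-local : ∀ {H H′} m → (∀ {n u} → n < m → length u < m → H n u ≡ H′ n u) → rep H m ≡ rep H′ m
    rep-local m h with decode m in eq
    ... | []    = refl
    ... | n ∷ u = let l , l′ = decode-bounds eq in emit-cong (length u) λ {j} _ →
      h l (≤-<-trans (≤-trans (≤-reflexive (length-take j u)) (m⊓n≤n j (length u))) l′)

    nth : List ℕ → ℕ → Maybe X
    nth []      _       = nothing
    nth (x ∷ u) zero    = just (prj x)
    nth (x ∷ u) (suc i) = nth u i

    nth-just : ∀ (f : ℕ → X) {N i} → i < N → nth (f ↾ N) i ≡ just (f i)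
    nth-just f {suc N} {zero}  _       = cong just (prj-emb (f 0))
    nth-just f {suc N} {suc i} (s≤s l) = nth-just (f ∘ suc) l

    nth-sound : ∀ (f : ℕ → X) N i {v} → nth (f ↾ N) i ≡ just v → v ≡ f i
    nth-sound f (suc N) zero    h = trans (sym (just-injective h)) (prj-emb (f 0))
    nth-sound f (suc N) (suc i) h = nth-sound (f ∘ suc) N i h

    Agree : ℕ → (ℕ → X) → (ℕ → X) → Set
    Agree m f g = ∀ {i} → i < m → f i ≡ g i

    weaken : ∀ {m n f g} → m ≤ n → Agree n f g → Agree m f g
    weaken l h l′ = h (≤-trans l′ l)

    ↾-cong : ∀ {f g} m → Agree m f g → f ↾ m ≡ g ↾ m
    ↾-cong m h = applyUpTo-cong m (cong emb ∘ h)

    ext : List ℕ → ℕ → X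
    ext u i = fromMaybe (prj 0) (nth u i)

    -- An operator whose value at m depends on its argument below m only is
    -- represented by waiting until that much of the argument is known.

    Local : ((ℕ → X) → ℕ → X) → Set
    Local Φ = ∀ {f g} m → Agree m f g → Φ f m ≡ Φ g m

    wait : ((ℕ → X) → ℕ → X) → ℕ → List ℕ → Maybe X
    wait Φ n u with n ≤? length u
    ... | yes _ = just (Φ (ext u) n)
    ... | no  _ = nothing

    delay : ((ℕ → X) → ℕ → X) → ℕ → X
    delay Φ = rep (wait Φ)

    delay-app : ∀ {Φ} → Local Φ → ∀ β → App (delay Φ) β (Φ β)
    delay-app {Φ} local β = rep-app (wait Φ) sound (λ n → n , complete n)
      where
      agree : ∀ {n j} → n ≤ j → Agree n (ext (β ↾ j)) β
      agree l l′ = cong (fromMaybe (prj 0)) (nth-just β (≤-trans l′ l))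

      sound : ∀ n j {v} → wait Φ n (β ↾ j) ≡ just v → v ≡ Φ β n
      sound n j h with n ≤? length (β ↾ j)
      sound n j refl | yes l =
        local n (agree (≤-trans l (≤-reflexive (length-applyUpTo (emb ∘ β) j))))

      complete : ∀ n → wait Φ n (β ↾ n) ≡ just (Φ β n)
      complete n with n ≤? length (β ↾ n)
      ... | yes _ = cong just (local n (agree ≤-refl))
      ... | no ¬l = contradiction (≤-reflexive (sym (length-applyUpTo (emb ∘ β) n))) ¬l

    wait-cong : ∀ {Φ Ψ n} u → Φ (ext u) n ≡ Ψ (ext u) n → wait Φ n u ≡ wait Ψ n u
    wait-cong {n = n} u h with n ≤? length u
    ... | yes _ = cong just h
    ... | no  _ = refl

    constant : (ℕ → X) → ℕ → X
    constant a = rep (λ n _ → just (a n))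

    constant-local : Local constant
    constant-local m h = rep-local m (λ l _ → cong just (h l))

    constant-app : ∀ a b → App (constant a) b a
    constant-app a b = rep-app (λ n _ → just (a n)) (λ _ _ h → sym (just-injective h)) (λ _ → 0 , refl)

    record Approximates (α′ : ℕ → ℕ → Maybe X) (α : ℕ → X) : Set where
      field
        sound    : ∀ N i {v} → α′ N i ≡ just v → v ≡ α i
        complete : ∀ i → Eventually λ N → α′ N i ≡ just (α i)
    open Approximates

    prefix : (ℕ → Maybe X) → ℕ → Maybe (List ℕ)
    prefix β′ zero    = just []
    prefix β′ (suc k) = β′ 0 >>= λ x → prefix (β′ ∘ suc) k >>= λ w → just (emb x ∷ w)

    prefix-sound : ∀ {β′} β k {w} → (∀ i {v} → β′ i ≡ just v → v ≡ β i) →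
                   prefix β′ k ≡ just w → w ≡ β ↾ k
    prefix-sound β zero h refl = refl
    prefix-sound {β′} β (suc k) h eq with β′ 0 in e₀ | prefix (β′ ∘ suc) k in e₁
    prefix-sound β (suc k) h refl | just x | just w =
      cong₂ _∷_ (cong emb (h 0 e₀)) (prefix-sound (β ∘ suc) k (h ∘ suc) e₁)

    prefix-complete : ∀ {β′} β k → (∀ {i} → i < k → β′ i ≡ just (β i)) → prefix β′ k ≡ just (β ↾ k)
    prefix-complete β zero    h = refl
    prefix-complete β (suc k) h rewrite h {0} (s≤s z≤n) | prefix-complete (β ∘ suc) k (h ∘ s≤s) = refl

    ask : (ℕ → Maybe X) → (ℕ → Maybe X) → ℕ → ℕ → Maybe X
    ask α′ β′ n k = prefix β′ k >>= λ w → α′ (code (n ∷ w))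

    apply : ℕ → (ℕ → Maybe X) → (ℕ → Maybe X) → ℕ → Maybe X
    apply N α′ β′ n = out N (ask α′ β′ n)

    apply-approximates : ∀ {α′ β′ α β δ} → Approximates α′ α → Approximates β′ β → App α β δ →
                         Approximates (λ N → apply N (α′ N) (β′ N)) δ
    apply-approximates {α′} {β′} {α} {β} A B h = record
      { sound    = λ N n → out-sound N (ask-sound N n) (h n)
      ; complete = λ n → out-complete (ask-complete n) (h n)
      }
      where
      ask-sound : ∀ N n k {x} → ask (α′ N) (β′ N) n k ≡ just x → x ≡ α (code (n ∷ β ↾ k))
      ask-sound N n k eq with prefix (β′ N) k in e
      ... | just w = trans (sound A N _ eq) (cong (λ w → α (code (n ∷ w))) (prefix-sound β k (sound B N) e))

      ask-complete : ∀ n k → Eventually λ N → ask (α′ N) (β′ N) n k ≡ just (α (code (n ∷ β ↾ k)))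
      ask-complete n k = eventually₂
        (λ {N} (p : ∀ {j} → j ≤ k → β′ N j ≡ just (β j)) q → trans
          (cong (_>>= λ w → α′ N (code (n ∷ w))) (prefix-complete β k (λ l → p (<⇒≤ l)))) q)
        (eventually-all {λ j N → β′ N j ≡ just (β j)} (complete B) k) (complete A (code (n ∷ β ↾ k)))

    restriction : ∀ f → Approximates (λ N → nth (f ↾ N)) f
    restriction f = record
      { sound    = nth-sound f
      ; complete = λ i → suc i , λ l → nth-just f l
      }

    both : ℕ → List ℕ → List ℕ → List ℕ → ℕ → Maybe X
    both N u v w = apply N (apply N (nth u) (nth w)) (apply N (nth v) (nth w))

    -- distribute a b applied to c computes (a c)(b c).

    stage : (ℕ → X) → (ℕ → X) → ℕ → List ℕ → Maybe X
    stage a b n u = both (length u) (a ↾ length u) (b ↾ length u) u n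

    distribute : (ℕ → X) → (ℕ → X) → ℕ → X
    distribute a b = rep (stage a b)

    distribute-app : ∀ {a b c x y z} → App a c x → App b c y → App x y z → App (distribute a b) c z
    distribute-app {a} {b} {c} {z = z} hx hy hz =
      rep-app (stage a b) (λ n j h → sound approx j n (trans (sym (same j n)) h))
                          (λ n → let N , h = complete approx n in N , trans (same N n) (h ≤-refl))
      where
      approx : Approximates (λ N → both N (a ↾ N) (b ↾ N) (c ↾ N)) z
      approx = apply-approximates
        (apply-approximates (restriction a) (restriction c) hx)
        (apply-approximates (restriction b) (restriction c) hy) hz

      same : ∀ j n → stage a b n (c ↾ j) ≡ both j (a ↾ j) (b ↾ j) (c ↾ j) n
      same j n = cong (λ N → both N (a ↾ N) (b ↾ N) (c ↾ j) n) (length-applyUpTo (emb ∘ c) j)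

    distribute-local : ∀ {a a′ b b′} m → Agree m a a′ → Agree m b b′ → distribute a b m ≡ distribute a′ b′ m
    distribute-local m ha hb = rep-local m λ {n} {u} _ l → cong₂ (λ v w → both (length u) v w u n)
      (↾-cong (length u) (weaken (<⇒≤ l) ha)) (↾-cong (length u) (weaken (<⇒≤ l) hb))

    distribute₁ : (ℕ → X) → ℕ → X
    distribute₁ a = delay (distribute a)

    distribute₁-local : Local distribute₁
    distribute₁-local m h = rep-local m λ {n} {u} l _ →
      wait-cong u (distribute-local n (weaken (<⇒≤ l) h) (λ _ → refl))

  open Evaluation pas

  private
    value : ∀ {a} → ` a ⇓ a
    value = val (λ _ → refl)

    K S : ℕ → X
    K = delay constant
    S = delay distribute₁

    S₂ : ∀ a b → ` S ∙ ` a ∙ ` b ⇓ distribute a b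
    S₂ a b = app (app value value (delay-app distribute₁-local a)) value
                 (delay-app (λ m h → distribute-local m (λ _ → refl) h) b)

    S₃ : ∀ a b c {d} → (` a ∙ ` c) ∙ (` b ∙ ` c) ⇓ d → ` S ∙ ` a ∙ ` b ∙ ` c ⇓ d
    S₃ a b c (app (app (val ha) (val hc) hx) (app (val hb) (val hc′) hy) hz) =
      app (S₂ a b) value (distribute-app
        (PAS.·-resp pas (sym ∘ ha) (sym ∘ hc) (λ _ → refl) hx)
        (PAS.·-resp pas (sym ∘ hb) (sym ∘ hc′) (λ _ → refl) hy) hz)

  pca : PCA 0ℓ 0ℓ 0ℓ
  pca = record
    { pas   = pas
    ; k     = K
    ; s     = S
    ; k-law = λ a b → app (app value value (delay-app constant-local a)) value (constant-app a b)
    ; s-def = λ a b → distribute a b , S₂ a b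
    ; s-law = S₃
    }

_·𝒦₂_↦_ : (ℕ → ℕ) → (ℕ → ℕ) → (ℕ → ℕ) → Set
α ·𝒦₂ β ↦ δ = ∀ n → ∃ λ k →
  α (code (n ∷ applyUpTo β k)) ≡ suc (δ n) ×
  (∀ {j} → j < k → α (code (n ∷ applyUpTo β j)) ≡ 0)

private
  least : ∀ {X : Set} (g : ℕ → Maybe X) N {y} → g N ≡ just y →
          ∃₂ λ k v → g k ≡ just v × (∀ {j} → j < k → g j ≡ nothing)
  least g zero    h = 0 , _ , h , λ ()
  least g (suc N) h with g 0 in e
  ... | just v  = 0 , v , e , λ ()
  ... | nothing with least (g ∘ suc) N h
  ... | k , v , hk , below = suc k , v , hk , λ { {zero} _ → e ; {suc j} (s≤s l) → below l }

  module 𝒦₂-protocol where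
    Out : (ℕ → ℕ) → ℕ → Set
    Out q y = ∃ λ k → q k ≡ suc y × (∀ {j} → j < k → q j ≡ 0)

    functional : ∀ {q y y′} → Out q y → Out q y′ → y ≡ y′
    functional (k , h , z) (k′ , h′ , z′) with <-cmp k k′
    ... | tri< l _ _ = contradiction (trans (sym (z′ l)) h) 0≢1+n
    ... | tri≈ _ refl _ = suc-injective (trans (sym h) h′)
    ... | tri> _ _ l = contradiction (trans (sym (z l)) h′) 0≢1+n

    step : Maybe ℕ → Maybe ℕ → Maybe ℕ
    step nothing        _ = nothing
    step (just zero)    r = r
    step (just (suc y)) _ = just y

    out : ℕ → (ℕ → Maybe ℕ) → Maybe ℕ
    out zero    q′ = nothing
    out (suc N) q′ = step (q′ 0) (out N (q′ ∘ suc))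

    sound : ∀ N {q′ q y v} → (∀ k {x} → q′ k ≡ just x → x ≡ q k) →
            Out q y → out N q′ ≡ just v → v ≡ y
    sound (suc N) {q′} ok (k , h , z) eq with q′ 0 in e
    sound (suc N) ok (zero , h , z) eq | just zero = contradiction (trans (ok 0 e) h) 0≢1+n
    sound (suc N) ok (suc k , h , z) eq | just zero =
      sound N (ok ∘ suc) (k , h , λ l → z (s≤s l)) eq
    sound (suc N) ok (zero , h , z) refl | just (suc y) = suc-injective (trans (ok 0 e) h)
    sound (suc N) ok (suc k , h , z) eq | just (suc y) =
      contradiction (trans (sym (z (s≤s z≤n))) (sym (ok 0 e))) 0≢1+n

    run : ∀ {N q′ y} k → k < N → q′ k ≡ just (suc y) → (∀ {j} → j < k → q′ j ≡ just 0) →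
          out N q′ ≡ just y
    run zero (s≤s _) h z rewrite h = refl
    run (suc k) (s≤s l) h z rewrite z {0} (s≤s z≤n) = run k l h (λ l′ → z (s≤s l′))

    complete : ∀ {q′ : ℕ → ℕ → Maybe ℕ} {q y} → (∀ k → Eventually λ N → q′ N k ≡ just (q k)) →
               Out q y → Eventually λ N → out N (q′ N) ≡ just y
    complete {q′} {q} ok (k , h , z) = eventually₂
      (λ {N} (p : ∀ {j} → j ≤ k → q′ N j ≡ just (q j)) l →
        run k l (trans (p ≤-refl) (cong just h)) (λ l′ → trans (p (<⇒≤ l′)) (cong just (z l′))))
      (eventually-all {λ j N → q′ N j ≡ just (q j)} ok k) (suc k , id)

    answer : Maybe ℕ → ℕ
    answer nothing  = 0
    answer (just y) = suc y

    protocol : Protocol ℕ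
    protocol = record
      { emb            = id
      ; prj            = id
      ; prj-emb        = λ _ → refl
      ; Out            = Out
      ; Out-resp       = λ e (k , h , z) → k , trans (sym (e k)) h , λ l → trans (sym (e _)) (z l)
      ; Out-functional = functional
      ; out            = out
      ; out-sound      = sound
      ; out-complete   = complete
      ; emit           = λ g → answer ∘ g
      ; emit-cong      = λ k h → cong answer (h ≤-refl)
      ; emit-out       = λ {g} s (N , h) → let k , v , hk , z = least g N h in
                           k , trans (cong answer hk) (cong suc (s k hk)) , λ l → cong answer (z l)
      }

𝒦₂ : PCA 0ℓ 0ℓ 0ℓ
𝒦₂ = record
  { pas   = record
      { setoid       = ℕ →-setoid ℕ
      ; _·_↦_        = _·𝒦₂_↦_
      ; ·-resp       = M.·-resp
      ; ·-functional = λ {a} {b} → M.·-functional {a} {b}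
      }
  ; k     = M.k
  ; s     = M.s
  ; k-law = M.k-law
  ; s-def = M.s-def
  ; s-law = M.s-law
  }
  where module M = PCA (FunctionModel.pca 𝒦₂-protocol.protocol)

_·2^ω_↦_ : (ℕ → Fin 2) → (ℕ → Fin 2) → (ℕ → Fin 2) → Set
α ·2^ω β ↦ δ = ∀ n → ∃ λ k →
  α (code (n ∷ applyUpTo (toℕ ∘ β) k)) ≡ 1F ×
  (∀ {j} → j < k → α (code (n ∷ applyUpTo (toℕ ∘ β) j)) ≢ 1F) ×
  δ n ≡ α (code (n ∷ applyUpTo (toℕ ∘ β) (suc k)))

private
  module 2^ω-protocol where
    Out : (ℕ → Fin 2) → Fin 2 → Set
    Out q y = ∃ λ k → q k ≡ 1F × (∀ {j} → j < k → q j ≢ 1F) × y ≡ q (suc k)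

    prj : ℕ → Fin 2
    prj zero    = 0F
    prj (suc _) = 1F

    prj-emb : ∀ x → prj (toℕ x) ≡ x
    prj-emb 0F = refl
    prj-emb 1F = refl

    is0 : ∀ {x : Fin 2} → x ≢ 1F → x ≡ 0F
    is0 {0F} h = refl
    is0 {1F} h = contradiction refl h

    functional : ∀ {q y y′} → Out q y → Out q y′ → y ≡ y′
    functional (k , h , z , w) (k′ , h′ , z′ , w′) with <-cmp k k′
    ... | tri< l _ _ = contradiction h (z′ l)
    ... | tri≈ _ refl _ = trans w (sym w′)
    ... | tri> _ _ l = contradiction h′ (z l)

    step : Maybe (Fin 2) → Maybe (Fin 2) → Maybe (Fin 2) → Maybe (Fin 2)
    step nothing   _ _ = nothing
    step (just 0F) _ r = r
    step (just 1F) v _ = v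

    out : ℕ → (ℕ → Maybe (Fin 2)) → Maybe (Fin 2)
    out zero    q′ = nothing
    out (suc N) q′ = step (q′ 0) (q′ 1) (out N (q′ ∘ suc))

    sound : ∀ N {q′ q y v} → (∀ k {x} → q′ k ≡ just x → x ≡ q k) →
            Out q y → out N q′ ≡ just v → v ≡ y
    sound (suc N) {q′} ok (k , h , z , w) eq with q′ 0 in e
    sound (suc N) ok (zero , h , z , w) eq | just 0F = contradiction (trans (ok 0 e) h) λ ()
    sound (suc N) ok (suc k , h , z , w) eq | just 0F =
      sound N (ok ∘ suc) (k , h , (λ l → z (s≤s l)) , w) eq
    sound (suc N) ok (zero , h , z , w) eq | just 1F = trans (ok 1 eq) (sym w)
    sound (suc N) ok (suc k , h , z , w) eq | just 1F = contradiction (sym (ok 0 e)) (z (s≤s z≤n))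

    run : ∀ {N q′ y} k → k < N → q′ k ≡ just 1F → (∀ {j} → j < k → q′ j ≡ just 0F) →
          q′ (suc k) ≡ just y → out N q′ ≡ just y
    run zero (s≤s _) h z w rewrite h = w
    run (suc k) (s≤s l) h z w rewrite z {0} (s≤s z≤n) = run k l h (λ l′ → z (s≤s l′)) w

    complete : ∀ {q′ : ℕ → ℕ → Maybe (Fin 2)} {q y} →
               (∀ k → Eventually λ N → q′ N k ≡ just (q k)) →
               Out q y → Eventually λ N → out N (q′ N) ≡ just y
    complete {q′} {q} ok (k , h , z , w) = eventually₂
      (λ {N} (p : ∀ {j} → j ≤ suc k → q′ N j ≡ just (q j)) l →
        run k l (trans (p (n≤1+n k)) (cong just h))
          (λ l′ → trans (p (<⇒≤ (m≤n⇒m≤1+n l′))) (cong just (is0 (z l′))))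
          (trans (p ≤-refl) (cong just (sym w))))
      (eventually-all {λ j N → q′ N j ≡ just (q j)} ok (suc k)) (suc k , id)

    flag : Maybe (Fin 2) → Fin 2
    flag nothing  = 0F
    flag (just _) = 1F

    answer : Maybe (Fin 2) → Maybe (Fin 2) → Fin 2
    answer nothing  y = flag y
    answer (just y) _ = y

    emit : (ℕ → Maybe (Fin 2)) → ℕ → Fin 2
    emit g zero    = flag (g 0)
    emit g (suc k) = answer (g k) (g (suc k))

    emit-cong : ∀ {g g′} k → (∀ {j} → j ≤ k → g j ≡ g′ j) → emit g k ≡ emit g′ k
    emit-cong zero    h = cong flag (h z≤n)
    emit-cong (suc k) h = cong₂ answer (h (n≤1+n k)) (h ≤-refl)

    emit-first : ∀ {g} k {v} → g k ≡ just v → (∀ {j} → j < k → g j ≡ nothing) → emit g k ≡ 1F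
    emit-first zero    h z rewrite h = refl
    emit-first (suc k) h z rewrite h | z {k} ≤-refl = refl

    emit-before : ∀ {g} k → (∀ {j} → j ≤ k → g j ≡ nothing) → emit g k ≢ 1F
    emit-before zero    z rewrite z {0} ≤-refl = λ ()
    emit-before (suc k) z rewrite z {k} (n≤1+n k) | z {suc k} ≤-refl = λ ()

    emit-out : ∀ {g y} → (∀ j {v} → g j ≡ just v → v ≡ y) → (∃ λ j → g j ≡ just y) → Out (emit g) y
    emit-out {g} s (N , h) with least g N h
    ... | k , v , hk , z =
      k , emit-first k hk z , (λ {j} l → emit-before j (λ l′ → z (≤-<-trans l′ l))) ,
      trans (sym (s k hk)) (sym (cong (λ x → answer x (g (suc k))) hk))

    protocol : Protocol (Fin 2)
    protocol = record
      { emb            = toℕ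
      ; prj            = prj
      ; prj-emb        = prj-emb
      ; Out            = Out
      ; Out-resp       = λ e (k , h , z , w) →
          k , trans (sym (e k)) h , (λ l h′ → z l (trans (e _) h′)) , trans w (e (suc k))
      ; Out-functional = functional
      ; out            = out
      ; out-sound      = sound
      ; out-complete   = complete
      ; emit           = emit
      ; emit-cong      = emit-cong
      ; emit-out       = emit-out
      }

2^ω : PCA 0ℓ 0ℓ 0ℓ
2^ω = record
  { pas   = record
      { setoid       = ℕ →-setoid Fin 2
      ; _·_↦_        = _·2^ω_↦_
      ; ·-resp       = M.·-resp
      ; ·-functional = λ {a} {b} → M.·-functional {a} {b}
      }
  ; k     = M.k
  ; s     = M.s
  ; k-law = M.k-law
  ; s-def = M.s-def
  ; s-law = M.s-law
  }
  where module M = PCA (FunctionModel.pca 2^ω-protocol.protocol)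

-- i ∈ e k: a finite set p (a list without repetitions) with k = Σ_{j ∈ p} 2^j
-- contains i.

weight : List ℕ → ℕ
weight p = sum (map (2 ^_) p)

e : ℕ → Pred ℕ 0ℓ
e k i = ∃ λ p → Unique p × k ≡ weight p × i ∈ p

infixl 7 _∘ₚ_
_∘ₚ_ : Pred ℕ 0ℓ → Pred ℕ 0ℓ → Pred ℕ 0ℓ
(A ∘ₚ B) n = ∃ λ m → A ⟨ m , n ⟩ × e m ⊆ B

private
  parity : ∀ m → ∃ λ q → m ≡ q + q ⊎ m ≡ suc (q + q)
  parity zero    = 0 , inj₁ refl
  parity (suc m) with parity m
  ... | q , inj₁ h = q , inj₂ (cong suc h)
  ... | q , inj₂ h = suc q , inj₁ (trans (cong suc h) (cong suc (sym (+-suc q q))))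

  weight-map-suc : ∀ p → weight (map suc p) ≡ weight p + weight p
  weight-map-suc []      = refl
  weight-map-suc (i ∷ p) rewrite weight-map-suc p | +-identityʳ (2 ^ i) =
    interchange (2 ^ i) (weight p)
    where
    interchange : ∀ a b → a + a + (b + b) ≡ a + b + (a + b)
    interchange a b = trans (+-assoc a a (b + b)) (trans (cong (a +_)
      (trans (sym (+-assoc a b b)) (trans (cong (_+ b) (+-comm a b)) (+-assoc b a b))))
      (sym (+-assoc a b (a + b))))

  expansion : ∀ m → ∃ λ p → Unique p × m ≡ weight p
  expansion = <-rec _ go
    where
    go : ∀ m → (∀ {q} → q < m → ∃ λ p → Unique p × q ≡ weight p) → ∃ λ p → Unique p × m ≡ weight p
    go zero rec = [] , [] , refl
    go m@(suc _) rec with parity m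
    go m@(suc _) rec | suc q , inj₁ h with rec {suc q} (subst (suc q <_) (sym h) (m<m+n (suc q) (s≤s z≤n)))
    ... | p , u , w = map suc p , map⁺ suc-injective u ,
      trans h (trans (cong₂ _+_ w w) (sym (weight-map-suc p)))
    go m@(suc _) rec | q , inj₂ h with rec {q} (subst (q <_) (sym h) (s≤s (m≤m+n q q)))
    ... | p , u , w = 0 ∷ map suc p , fresh p ∷ map⁺ suc-injective u ,
      trans h (cong suc (trans (cong₂ _+_ w w) (sym (weight-map-suc p))))
      where
      fresh : ∀ p → All (0 ≢_) (map suc p)
      fresh []      = []
      fresh (_ ∷ p) = (λ ()) ∷ fresh p

  down : List ℕ → List ℕ
  down []          = []
  down (zero ∷ p)  = down p
  down (suc i ∷ p) = i ∷ down p

  ∈-down⁺ : ∀ {i} p → suc i ∈ p → i ∈ down p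
  ∈-down⁺ (zero ∷ p)  (there h)   = ∈-down⁺ p h
  ∈-down⁺ (suc _ ∷ p) (here refl) = here refl
  ∈-down⁺ (suc _ ∷ p) (there h)   = there (∈-down⁺ p h)

  ∈-down⁻ : ∀ {i} p → i ∈ down p → suc i ∈ p
  ∈-down⁻ (zero ∷ p)  h           = there (∈-down⁻ p h)
  ∈-down⁻ (suc _ ∷ p) (here refl) = here refl
  ∈-down⁻ (suc _ ∷ p) (there h)   = there (∈-down⁻ p h)

  All-∉ : ∀ {i : ℕ} {p} → ¬ i ∈ p → All (i ≢_) p
  All-∉ {p = []}    h = []
  All-∉ {p = _ ∷ p} h = (λ { refl → h (here refl) }) ∷ All-∉ (h ∘ there)

  down-unique : ∀ {p} → Unique p → Unique (down p)
  down-unique [] = []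
  down-unique {zero ∷ p}  (_ ∷ u) = down-unique u
  down-unique {suc i ∷ p} (f ∷ u) = All-∉ (λ h → All-lookup f (∈-down⁻ p h) refl) ∷ down-unique u

  double-weight : ∀ i p → 2 ^ suc i + (weight (down p) + weight (down p)) ≡
                          weight (i ∷ down p) + weight (i ∷ down p)
  double-weight i p = trans (cong (2 ^ suc i +_) (sym (weight-map-suc (down p)))) (weight-map-suc (i ∷ down p))

  weight-even : ∀ {p} → ¬ 0 ∈ p → weight p ≡ weight (down p) + weight (down p)
  weight-even {[]}        h = refl
  weight-even {zero ∷ p}  h = contradiction (here refl) h
  weight-even {suc i ∷ p} h =
    trans (cong (2 ^ suc i +_) (weight-even {p} (h ∘ there))) (double-weight i p)

  weight-odd : ∀ {p} → Unique p → 0 ∈ p → weight p ≡ suc (weight (down p) + weight (down p))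
  weight-odd {zero ∷ p}  (f ∷ u) h         = cong suc (weight-even (λ h′ → All-lookup f h′ refl))
  weight-odd {suc i ∷ p} (f ∷ u) (there h) =
    trans (cong (2 ^ suc i +_) (weight-odd u h))
          (trans (+-suc (2 ^ suc i) _) (cong suc (double-weight i p)))

  odd≢even : ∀ m n → suc (m + m) ≢ n + n
  odd≢even zero    (suc n) h = contradiction (trans (suc-injective h) (+-suc n n)) 0≢1+n
  odd≢even (suc m) (suc n) h = odd≢even m n
    (suc-injective (trans (sym (+-suc (suc m) m)) (suc-injective (trans h (cong suc (+-suc n n))))))

  halve : ∀ m n → m + m ≡ n + n → m ≡ n
  halve zero    zero    h = refl
  halve (suc m) (suc n) h = cong suc (halve m n
    (suc-injective (trans (sym (+-suc m m)) (trans (suc-injective h) (+-suc n n)))))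

  weight-∈ : ∀ i {p q} → Unique p → Unique q → weight p ≡ weight q → i ∈ p → i ∈ q
  weight-∈ zero {p} {q} u v h l with 0 ∈? q
  ... | yes l′ = l′
  ... | no ¬l′ = contradiction (trans (sym (weight-odd u l)) (trans h (weight-even ¬l′)))
                               (odd≢even (weight (down p)) (weight (down q)))
  weight-∈ (suc i) {p} {q} u v h l =
    ∈-down⁻ q (weight-∈ i (down-unique u) (down-unique v) same (∈-down⁺ p l))
    where
    same : weight (down p) ≡ weight (down q)
    same with 0 ∈? p | 0 ∈? q
    ... | yes a | yes b = halve _ _ (suc-injective (trans (sym (weight-odd u a)) (trans h (weight-odd v b))))
    ... | no ¬a | no ¬b = halve _ _ (trans (sym (weight-even ¬a)) (trans h (weight-even ¬b)))
    ... | yes a | no ¬b = contradiction (weight-∈ 0 u v h a) ¬b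
    ... | no ¬a | yes b = contradiction (weight-∈ 0 v u (sym h) b) ¬a

  index : List ℕ → ℕ
  index p = weight (deduplicate _≟_ p)

  e-index⁻ : ∀ p {i} → e (index p) i → i ∈ p
  e-index⁻ p (q , u , h , l) =
    ∈-deduplicate⁻ _≟_ p (weight-∈ _ u (deduplicate-! _≟_ p) (sym h) l)

  e-index⁺ : ∀ p {i} → i ∈ p → e (index p) i
  e-index⁺ p l = deduplicate _≟_ p , deduplicate-! _≟_ p , refl , ∈-deduplicate⁺ _≟_ l

  members : ∀ m → ∃ λ p → (∀ {i} → e m i → i ∈ p) × (∀ {i} → i ∈ p → e m i)
  members m with expansion m
  ... | p , u , h = p , (λ (q , v , h′ , l) → weight-∈ _ v u (trans (sym h′) h) l) , λ l → p , u , h , l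

  ∘ₚ-mono : ∀ A A′ B B′ → A ⊆ A′ → B ⊆ B′ → A ∘ₚ B ⊆ A′ ∘ₚ B′
  ∘ₚ-mono A A′ B B′ h h′ (m , a , b) = m , h a , λ l → h′ (b l)

  first second : ℕ → ℕ
  first  i = proj₁ (unpair i)
  second i = proj₂ (unpair i)

  Kₚ : Pred ℕ 0ℓ
  Kₚ i = e (first i) (second (second i))

  Sₚ : Pred ℕ 0ℓ
  Sₚ i = let a = e (first i); i′ = second i; b = e (first i′); i″ = second i′; c = e (first i″) in
         ((a ∘ₚ c) ∘ₚ (b ∘ₚ c)) (second i″)

  finite : ∀ (A : Pred ℕ 0ℓ) p → (∀ {i} → i ∈ p → A i) → e (index p) ⊆ A
  finite A p h l = h (e-index⁻ p l)

  e⊆index : ∀ m p → (∀ {i} → i ∈ proj₁ (members m) → i ∈ p) → e m ⊆ e (index p)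
  e⊆index m p h l = e-index⁺ p (h (proj₁ (proj₂ (members m)) l))

  member : ∀ m {i} → i ∈ proj₁ (members m) → e m i
  member m = proj₂ (proj₂ (members m))

  union : ∀ m n (A : Pred ℕ 0ℓ) → e m ⊆ A → e n ⊆ A →
          ∀ {i} → i ∈ proj₁ (members m) ++ proj₁ (members n) → A i
  union m n A h h′ l with ∈-++⁻ (proj₁ (members m)) l
  ... | inj₁ l′ = h (member m l′)
  ... | inj₂ l′ = h′ (member n l′)

  -- Only finitely much of A and C is used in computing finitely many elements of A ∘ₚ C.

  compact : ∀ A C p → (∀ {i} → i ∈ p → (A ∘ₚ C) i) → ∃₂ λ a c →
            e a ⊆ A × e c ⊆ C × (∀ {i} → i ∈ p → (e a ∘ₚ e c) i)
  compact A C [] h = index [] , index [] , finite A [] (λ ()) , finite C [] (λ ()) , λ ()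
  compact A C (i ∷ p) h with h (here refl) | compact A C p (h ∘ there)
  ... | m , l , sub | a , c , ha , hc , hp =
    index u , index w ,
    finite A u (λ { (here refl) → l ; (there l′) → ha (member a l′) }) ,
    finite C w (union m c C sub hc) ,
    λ { (here refl) → m , e-index⁺ u (here refl) , e⊆index m w ∈-++⁺ˡ
      ; (there l′)  → ∘ₚ-mono (e a) (e (index u)) (e c) (e (index w))
          (e⊆index a u there) (e⊆index c w (∈-++⁺ʳ (proj₁ (members m)))) (hp l′) }
    where
    u w : List ℕ
    u = ⟨ m , i ⟩ ∷ proj₁ (members a)
    w = proj₁ (members m) ++ proj₁ (members c)

  Kₚ-law : ∀ A B → Kₚ ∘ₚ A ∘ₚ B ≐ A
  Kₚ-law A B = to , from
    where
    to : Kₚ ∘ₚ A ∘ₚ B ⊆ A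
    to {n} (m′ , (m , h , sub) , _)
      rewrite unpair-pair m ⟨ m′ , n ⟩ | unpair-pair m′ n = sub h

    from : A ⊆ Kₚ ∘ₚ A ∘ₚ B
    from {n} l = index [] ,
      (index (n ∷ []) , mem , finite A (n ∷ []) λ { (here refl) → l }) , finite B [] λ ()
      where
      mem : Kₚ ⟨ index (n ∷ []) , ⟨ index [] , n ⟩ ⟩
      mem rewrite unpair-pair (index (n ∷ [])) ⟨ index [] , n ⟩ | unpair-pair (index []) n =
        e-index⁺ (n ∷ []) (here refl)

  Sₚ-pair : ∀ a b c n → Sₚ ⟨ a , ⟨ b , ⟨ c , n ⟩ ⟩ ⟩ ≡ ((e a ∘ₚ e c) ∘ₚ (e b ∘ₚ e c)) n
  Sₚ-pair a b c n
    rewrite unpair-pair a ⟨ b , ⟨ c , n ⟩ ⟩ | unpair-pair b ⟨ c , n ⟩ | unpair-pair c n = refl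

  ∘ₚ-mono₃ : ∀ A A′ B B′ C C′ → A ⊆ A′ → B ⊆ B′ → C ⊆ C′ →
             (A ∘ₚ C) ∘ₚ (B ∘ₚ C) ⊆ (A′ ∘ₚ C′) ∘ₚ (B′ ∘ₚ C′)
  ∘ₚ-mono₃ A A′ B B′ C C′ ha hb hc =
    ∘ₚ-mono (A ∘ₚ C) (A′ ∘ₚ C′) (B ∘ₚ C) (B′ ∘ₚ C′) (∘ₚ-mono A A′ C C′ ha hc) (∘ₚ-mono B B′ C C′ hb hc)

  Sₚ-law : ∀ A B C → Sₚ ∘ₚ A ∘ₚ B ∘ₚ C ≐ (A ∘ₚ C) ∘ₚ (B ∘ₚ C)
  Sₚ-law A B C = to , from
    where
    to : Sₚ ∘ₚ A ∘ₚ B ∘ₚ C ⊆ (A ∘ₚ C) ∘ₚ (B ∘ₚ C)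
    to {n} (c , (b , (a , h , ha) , hb) , hc) =
      ∘ₚ-mono₃ (e a) A (e b) B (e c) C ha hb hc (subst id (Sₚ-pair a b c n) h)

    from : (A ∘ₚ C) ∘ₚ (B ∘ₚ C) ⊆ Sₚ ∘ₚ A ∘ₚ B ∘ₚ C
    from {n} (m , h , sub)
      with compact A C (⟨ m , n ⟩ ∷ []) (λ { (here refl) → h })
         | compact B C (proj₁ (members m)) (λ l → sub (member m l))
    ... | a , c₁ , ha , hc₁ , h₁ | b , c₂ , hb , hc₂ , h₂ =
      index w , (b , (a , subst id (sym (Sₚ-pair a b (index w) n)) inside , ha) , hb) ,
      finite C w (union c₁ c₂ C hc₁ hc₂)
      where
      w : List ℕ
      w = proj₁ (members c₁) ++ proj₁ (members c₂)

      inside : ((e a ∘ₚ e (index w)) ∘ₚ (e b ∘ₚ e (index w))) n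
      inside = m ,
        ∘ₚ-mono (e a) (e a) (e c₁) (e (index w)) id (e⊆index c₁ w ∈-++⁺ˡ) (h₁ (here refl)) ,
        λ l → ∘ₚ-mono (e b) (e b) (e c₂) (e (index w)) id
          (e⊆index c₂ w (∈-++⁺ʳ (proj₁ (members c₁)))) (h₂ (proj₁ (proj₂ (members m)) l))

𝒫ℕ-pas : PAS (lsuc 0ℓ) 0ℓ 0ℓ
𝒫ℕ-pas = record
  { setoid       = ≐-setoid ℕ 0ℓ
  ; _·_↦_        = λ A B C → A ∘ₚ B ≐ C
  ; ·-resp       = λ {A} {A′} {B} {B′} (a , a′) (b , b′) (c , c′) (h , h′) →
      (λ l → c (h (∘ₚ-mono A′ A B′ B a′ b′ l))) , (λ l → ∘ₚ-mono A A′ B B′ a b (h′ (c′ l)))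
  ; ·-functional = λ (h₁ , h₂) (h₃ , h₄) → (λ l → h₃ (h₂ l)) , (λ l → h₁ (h₄ l))
  }

private
  module Sₚ-derivation where
    open PAS 𝒫ℕ-pas using (≈-refl; ≈-trans)
    open Evaluation 𝒫ℕ-pas

    apply₁ : ∀ {t v} A → t ⇓ v → t ∙ ` A ⇓ v ∘ₚ A
    apply₁ {v = v} A d = app d (val (≈-refl {A})) (≈-refl {v ∘ₚ A})

    S₂ : ∀ A B → ` Sₚ ∙ ` A ∙ ` B ⇓ Sₚ ∘ₚ A ∘ₚ B
    S₂ A B = apply₁ B (apply₁ A (val (≈-refl {Sₚ})))

    K₂ : ∀ A B → ` Kₚ ∙ ` A ∙ ` B ⇓ A
    K₂ A B = ⇓-resp (Kₚ-law A B) (apply₁ B (apply₁ A (val (≈-refl {Kₚ}))))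

    S₃ : ∀ A B C {Z} → (` A ∙ ` C) ∙ (` B ∙ ` C) ⇓ Z → ` Sₚ ∙ ` A ∙ ` B ∙ ` C ⇓ Z
    S₃ A B C {Z} d = ⇓-resp (≈-trans {_} {(A ∘ₚ C) ∘ₚ (B ∘ₚ C)} {Z} (Sₚ-law A B C) (⇓-functional d′ d))
                            (apply₁ C (S₂ A B))
      where
      d′ : (` A ∙ ` C) ∙ (` B ∙ ` C) ⇓ (A ∘ₚ C) ∘ₚ (B ∘ₚ C)
      d′ = app (apply₁ C (val (≈-refl {A}))) (apply₁ C (val (≈-refl {B}))) (≈-refl {(A ∘ₚ C) ∘ₚ (B ∘ₚ C)})

𝒫ℕ : PCA (lsuc 0ℓ) 0ℓ 0ℓ
𝒫ℕ = record
  { pas   = 𝒫ℕ-pas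
  ; k     = Kₚ
  ; s     = Sₚ
  ; k-law = K₂
  ; s-def = λ A B → Sₚ ∘ₚ A ∘ₚ B , S₂ A B
  ; s-law = S₃
  }
  where open Sₚ-derivation

data Model : Set where
  scott kleene cantor : Model

carrierLevel : Model → Level
carrierLevel scott  = lsuc 0ℓ
carrierLevel kleene = 0ℓ
carrierLevel cantor = 0ℓ

⟦_⟧ : (M : Model) → PCA (carrierLevel M) 0ℓ 0ℓ
⟦ scott ⟧  = 𝒫ℕ
⟦ kleene ⟧ = 𝒦₂
⟦ cantor ⟧ = 2^ω

{-# OPTIONS --safe #-}
module Submission where

open import Defs
open import Axiom.ExcludedMiddle using (ExcludedMiddle)
open import Data.Bool using (Bool; true; false; if_then_else_)
open import Data.Empty using (⊥)
open import Data.Fin using (Fin; toℕ)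
open import Data.Fin.Patterns using (0F; 1F)
open import Data.Fin.Properties using (toℕ-injective)
open import Data.List using (List; []; _∷_; _++_; applyUpTo; filter; upTo)
open import Data.List.Membership.Propositional using (_∈_)
open import Data.List.Membership.Propositional.Properties using (∈-filter⁺; ∈-upTo⁺)
open import Data.List.Relation.Unary.All using (All; []; _∷_)
  renaming (head to All-head; map to All-map; lookup to All-lookup)
open import Data.List.Relation.Unary.All.Properties
  using (++⁺; ++⁻ˡ; ++⁻ʳ; applyUpTo⁺₂; applyUpTo⁻; all-filter)
open import Data.List.Relation.Unary.Any using (here; there)
open import Data.Maybe using (Maybe; just; nothing)
open import Data.Nat using (ℕ; zero; _+_; _^_; _≤_; _<_; z≤n; s≤s)
open import Data.Nat.Properties
  using (≤-refl; ≤-trans; ≤-reflexive; <⇒≤; <-trans; <-cmp; m≤m+n; m≤n+m; n≤1+n; m≤n⇒m≤1+n;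
         +-mono-≤; +-identityʳ; m^n>0; suc-injective; 0≢1+n)
open import Data.Product using (∃; ∃₂; _×_; _,_; proj₁; proj₂)
open import Data.Product.Properties using (,-injective)
open import Data.Sum using (inj₁; inj₂)
open import Data.Unit using (⊤; tt)
open import Function using (_∘_; id)
open import Level using (Level; 0ℓ; suc; Lift; lift; lower; _⊔_)
open import Relation.Binary using (tri<; tri≈; tri>)
open import Relation.Binary.PropositionalEquality
  using (_≡_; _≢_; _≗_; refl; sym; trans; cong; cong₂; subst)
open import Relation.Nullary using (¬_; does; contradiction)
open import Relation.Nullary.Decidable using (map′; decidable-stable; dec-true; dec-false)
open import Relation.Unary using (Pred; _≐_)

-- Fix a decidable applicative morphism γ : 𝒜[Eq] → ℬ.  For every a ∈ 𝒜 the
-- function b ↦ Eq([a , b]) is represented in 𝒜[Eq] by some χ a, so for chosen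
-- realizers tₐ ∈ γ(χ a) and xₐ ∈ γ(a) the term d (r tₐ x_b) of ℬ has value T if
-- a = b and F otherwise.  Application in ℬ is continuous and some observable
-- property tells T from F; so the value T at (tₐ , xₐ) is forced by finitely much
-- information about tₐ and xₐ, and this information determines a.  Hence 𝒜 is
-- countable, which contradicts Cantor's theorem.

-- Cantor's theorem for sequences of booleans.

lower-em : ExcludedMiddle (suc 0ℓ) → ExcludedMiddle 0ℓ
lower-em em {P} = map′ lower lift (em {Lift (suc 0ℓ) P})

-- The diagonal sequence is true at `n` exactly when some sequence numbered `n` is false at `n`; at
-- its own number either value is absurd. `f` may distinguish pointwise equal sequences.
cantor-diagonal : ExcludedMiddle 0ℓ → (f : (ℕ → Bool) → ℕ) → ¬ (∀ {a b} → f a ≡ f b → a ≗ b)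
cantor-diagonal em f injective = absent (diagonal , refl , excluded)
  where
  Excluded : ℕ → Set
  Excluded n = ∃ λ a → f a ≡ n × a n ≡ false

  diagonal : ℕ → Bool
  diagonal n = does (em {Excluded n})

  absent : ¬ Excluded (f diagonal)
  absent x@(a , fa , out) = contradiction
    (trans (sym out) (trans (injective fa (f diagonal)) (dec-true em x))) λ ()

  excluded : diagonal (f diagonal) ≡ false
  excluded = dec-false em absent

-- Evaluation of terms and combinatory completeness.

module _ {c e p} (A : PAS c e p) where
  open PAS A
  open Evaluation A

  ⇓-replaceʳ : ∀ {t u x v} → u ⇓ x → t ∙ ` x ⇓ v → t ∙ u ⇓ v
  ⇓-replaceʳ du (app dt (val q) h) = app dt (⇓-resp q du) h

  ⇓-replaceˡ : ∀ {t u x v} → t ⇓ x → ` x ∙ u ⇓ v → t ∙ u ⇓ v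
  ⇓-replaceˡ dt (app (val q) du h) = app (⇓-resp q dt) du h

  ⇓-contractˡ : ∀ {t u x v} → t ⇓ x → t ∙ u ⇓ v → ` x ∙ u ⇓ v
  ⇓-contractˡ dt (app dt′ du h) = app (val (⇓-functional dt dt′)) du h

-- Terms over Maybe Carrier are polynomials in one variable, nothing.

module Abstraction {c e p} (A : PCA c e p) where
  open PCA A

  _[_] : Term (Maybe Carrier) → Carrier → Term Carrier
  (` nothing) [ x ] = ` x
  (` just a)  [ x ] = ` a
  (t ∙ u)     [ x ] = t [ x ] ∙ u [ x ]

  k₁ : ∀ a → ∃ λ b → ` k ∙ ` a ⇓ b
  k₁ a with k-law a a
  ... | app d _ _ = _ , d

  -- Bracket abstraction, with `s k k` as the identity. It exists for every `t`, even one undefined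
  -- at some `x`, because `k a` and `s a b` are always defined.
  ƛ : Term (Maybe Carrier) → Carrier
  ƛ (` nothing) = proj₁ (s-def k k)
  ƛ (` just a)  = proj₁ (k₁ a)
  ƛ (t ∙ u)     = proj₁ (s-def (ƛ t) (ƛ u))

  ƛ-law : ∀ t x {v} → t [ x ] ⇓ v → ` ƛ t ∙ ` x ⇓ v
  ƛ-law (` nothing) x (val q) = ⇓-contractˡ pas (proj₂ (s-def k k))
    (⇓-resp q (s-law k k x (⇓-replaceʳ pas (proj₂ (k₁ x)) (k-law x _))))
  ƛ-law (` just a) x (val q) = ⇓-contractˡ pas (proj₂ (k₁ a)) (⇓-resp q (k-law a x))
  ƛ-law (t ∙ u) x (app dt du h) = ⇓-contractˡ pas (proj₂ (s-def (ƛ t) (ƛ u)))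
    (s-law (ƛ t) (ƛ u) x (app (ƛ-law t x dt) (ƛ-law u x du) h))

-- Representing the test for equality with a fixed element in `A [Eq] C`.

module EqualityTest {c e p} (A : PCA c e p) (C : Codings (PCA.pas A)) (yes′ no′ : PCA.Carrier A) where
  open PCA A
  open Codings C
  open Abstraction A

  private
    con : Carrier → Term (Maybe Carrier)
    con a = ` just a

    var : Term (Maybe Carrier)
    var = ` nothing

    D-replace : ∀ {t x a b v} → t ⇓ x → ` D ∙ ` x ∙ ` a ∙ ` b ⇓ v → ` D ∙ t ∙ ` a ∙ ` b ⇓ v
    D-replace dt (app (app d d₂ h₂) d₃ h₃) = app (app (⇓-replaceʳ pas dt d) d₂ h₂) d₃ h₃

    -- The oracle answers with `T` and `F` of `C`, whereas the booleans of `A [Eq] C` are an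
    -- independent choice; `D` translates the answer into `yes′` or `no′`, which will be those
    -- booleans.
    queryᵗ χᵗ : Carrier → Term (Maybe Carrier)
    replyᵗ : Term (Maybe Carrier)
    queryᵗ a = con pairing ∙ con F ∙ (con pairing ∙ con a ∙ (con proj ∙ con (num 0) ∙ var))
    replyᵗ = con pairing ∙ con T ∙ (con D ∙ (con proj ∙ con (num 1) ∙ var) ∙ con yes′ ∙ con no′)

    -- The branches are functions applied to the variable after the case
    -- distinction, since the second one need not be defined on [b].

    χᵗ a = con D ∙ (con isZero ∙ (con pred ∙ (con len ∙ var)))
             ∙ con (ƛ (queryᵗ a)) ∙ con (ƛ replyᵗ) ∙ var

  χ : Carrier → Carrier
  χ a = ƛ (χᵗ a)

  χ-step : ∀ a b {x w} → Eq pas C .PartialFunction.Graph (pair a b) x →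
           ` D ∙ ` x ∙ ` yes′ ∙ ` no′ ⇓ w → PAS._·_↦_ (pas [Eq] C) (χ a) b w
  χ-step a b {x} {w} graph h =
    -- One question is asked. With only the input `b` listed, the length minus one is zero and the
    -- query branch is taken; once the answer `x` is appended it is one, which selects the reply.
    1 , (λ _ → pair a b) , (λ _ → x) , (λ _ → graph) , (λ { (s≤s z≤n) → asks }) , returns
    where
    asks : ` χ a ∙ ` seq (b ∷ []) ⇓ pair F (pair a b)
    asks = ƛ-law (χᵗ a) (seq (b ∷ [])) (⇓-replaceˡ pas
      (D-replace (⇓-replaceʳ pas (⇓-replaceʳ pas (len-law (b ∷ [])) (pred-law 0)) isZero-zero)
                 (D-T (ƛ (queryᵗ a)) (ƛ replyᵗ)))
      (ƛ-law (queryᵗ a) (seq (b ∷ [])) (⇓-replaceʳ pas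
        (⇓-replaceʳ pas (proj-law (b ∷ []) 0F) (pairing-law a b)) (pairing-law F (pair a b)))))

    returns : ` χ a ∙ ` seq (b ∷ x ∷ []) ⇓ pair T w
    returns = ƛ-law (χᵗ a) (seq (b ∷ x ∷ [])) (⇓-replaceˡ pas
      (D-replace (⇓-replaceʳ pas (⇓-replaceʳ pas (len-law (b ∷ x ∷ [])) (pred-law 1)) (isZero-suc 0))
                 (D-F (ƛ (queryᵗ a)) (ƛ replyᵗ)))
      (ƛ-law replyᵗ (seq (b ∷ x ∷ [])) (⇓-replaceʳ pas
        (D-replace (proj-law (b ∷ x ∷ []) 1F) h) (pairing-law T w))))

  χ-≈ : ∀ {a b} → a ≈ b → PAS._·_↦_ (pas [Eq] C) (χ a) b yes′
  χ-≈ {a} {b} h = χ-step a b (a , b , ≈-refl , inj₁ (h , ≈-refl)) (D-T yes′ no′)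

  χ-≉ : ∀ {a b} → ¬ a ≈ b → PAS._·_↦_ (pas [Eq] C) (χ a) b no′
  χ-≉ {a} {b} h = χ-step a b (a , b , ≈-refl , inj₂ (h , ≈-refl)) (D-F yes′ no′)

-- Observable properties and continuity of application.

-- x ⊩ i: the i-th observable property holds of x.  The finite conjunctions of
-- these form a countable base for which application is continuous.

record Observations {c e p} (B : PAS c e p) : Set (suc 0ℓ ⊔ c ⊔ e ⊔ p) where
  open PAS B
  infix 4 _⊩_ _⊩*_ _⊑_
  field
    _⊩_ : Carrier → ℕ → Set

  _⊩*_ : Carrier → List ℕ → Set
  x ⊩* u = All (x ⊩_) u

  -- The specialization preorder: inclusion in the graph model, pointwise equality in the two
  -- function models.
  _⊑_ : Carrier → Carrier → Set
  x ⊑ y = ∀ i → x ⊩ i → y ⊩ i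

  field
    ⊩-resp     : ∀ {x y} → x ≈ y → x ⊑ y
    continuous : ∀ {x y z i} → x · y ↦ z → z ⊩ i → ∃₂ λ u v → x ⊩* u × y ⊩* v ×
                 (∀ {x′ y′ z′} → x′ ⊩* u → y′ ⊩* v → x′ · y′ ↦ z′ → z′ ⊩ i)
    distinct   : ∃₂ λ x y → ¬ x ⊑ y

module _ {c e p} {B : PAS c e p} (O : Observations B) where
  open PAS B
  open Evaluation B
  open Observations O

  -- The value carries a list of observations, not a single one, so that the notion composes: an
  -- observation of an application needs finitely many observations of each factor.
  Continuous : (Carrier → Carrier → Term Carrier) → Set _
  Continuous t = ∀ {x y z w} → t x y ⇓ z → z ⊩* w → ∃₂ λ u v → x ⊩* u × y ⊩* v ×
    (∀ {x′ y′ z′} → x′ ⊩* u → y′ ⊩* v → t x′ y′ ⇓ z′ → z′ ⊩* w)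

  ·-continuous* : ∀ {x y z w} → x · y ↦ z → z ⊩* w → ∃₂ λ u v → x ⊩* u × y ⊩* v ×
                  (∀ {x′ y′ z′} → x′ ⊩* u → y′ ⊩* v → x′ · y′ ↦ z′ → z′ ⊩* w)
  ·-continuous* h []       = [] , [] , [] , [] , λ _ _ _ → []
  ·-continuous* h (o ∷ os) with continuous h o | ·-continuous* h os
  ... | u , v , xu , yv , force | us , vs , xus , yvs , forces =
    u ++ us , v ++ vs , ++⁺ xu xus , ++⁺ yv yvs , λ hx hy h′ →
      force (++⁻ˡ u hx) (++⁻ˡ v hy) h′ ∷ forces (++⁻ʳ u hx) (++⁻ʳ v hy) h′

  value-⊩* : ∀ {a x w} → ` a ⇓ x → a ⊩* w → x ⊩* w
  value-⊩* (val q) = All-map (⊩-resp q _)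

  ⊩*-value : ∀ {a x w} → ` a ⇓ x → x ⊩* w → a ⊩* w
  ⊩*-value (val q) = All-map (⊩-resp (≈-sym q) _)

  constant-continuous : ∀ a → Continuous (λ _ _ → ` a)
  constant-continuous a d o = [] , [] , [] , [] , λ _ _ d′ → value-⊩* d′ (⊩*-value d o)

  first-continuous : Continuous (λ x _ → ` x)
  first-continuous d o = _ , [] , ⊩*-value d o , [] , λ hx _ d′ → value-⊩* d′ hx

  second-continuous : Continuous (λ _ y → ` y)
  second-continuous d o = [] , _ , [] , ⊩*-value d o , λ _ hy d′ → value-⊩* d′ hy

  ∙-continuous : ∀ {t t′} → Continuous t → Continuous t′ → Continuous (λ x y → t x y ∙ t′ x y)
  ∙-continuous ct ct′ (app d d′ h) o with ·-continuous* h o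
  ... | w , w′ , ow , ow′ , force with ct d ow | ct′ d′ ow′
  ... | u , v , xu , yv , forces | u′ , v′ , xu′ , yv′ , forces′ =
    u ++ u′ , v ++ v′ , ++⁺ xu xu′ , ++⁺ yv yv′ , λ { hx hy (app e e′ h′) →
      force (forces (++⁻ˡ u hx) (++⁻ˡ v hy) e) (forces′ (++⁻ʳ u hx) (++⁻ʳ v hy) e′) h′ }

  -- T ⊑ F would give a = D T a b ⊑ D F a b = b for all a and b.

  T⋢F : (bB : Booleans B) → ¬ Booleans.T bB ⊑ Booleans.F bB
  T⋢F bB T⊑F with distinct
  ... | a , b , a⋢b = a⋢b a⊑b
    where
    open Booleans bB

    a⊑b : a ⊑ b
    a⊑b i o with ∙-continuous (∙-continuous (∙-continuous (constant-continuous D) first-continuous)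
                   (constant-continuous a)) second-continuous (D-T a b) (o ∷ [])
    ... | u , v , Tu , bv , forces with forces (All-map (T⊑F _) Tu) bv (D-F a b)
    ... | o′ ∷ [] = o′

  T-F-separated : ExcludedMiddle 0ℓ → (bB : Booleans B) →
                  ∃ λ i → Booleans.T bB ⊩ i × ¬ Booleans.F bB ⊩ i
  T-F-separated em bB = decidable-stable em λ none →
    T⋢F bB λ i h → decidable-stable em λ h′ → none (i , h , h′)

-- Continuity of application in the three models.

scott-observations : ExcludedMiddle 0ℓ → Observations 𝒫ℕ-pas
scott-observations em = record
  { _⊩_        = λ A i → A i
  ; ⊩-resp     = λ (to , _) _ → to
  ; continuous = λ { {B} {B′} {i = i} (_ , from) o → observe B B′ (from o) }
  ; distinct   = (λ _ → ⊤) , (λ _ → ⊥) , λ h → h 0 tt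
  }
  where
  ∈⇒≤weight : ∀ {i} p → i ∈ p → i ≤ weight p
  ∈⇒≤weight (i ∷ p) (here refl) = ≤-trans (<⇒≤ (n<2^n i)) (m≤m+n (2 ^ i) (weight p))
    where
    n<2^n : ∀ n → n < 2 ^ n
    n<2^n zero      = s≤s z≤n
    n<2^n (ℕ.suc n) = ≤-trans (+-mono-≤ (m^n>0 2 n) (n<2^n n))
      (≤-reflexive (cong (2 ^ n +_) (sym (+-identityʳ (2 ^ n)))))
  ∈⇒≤weight (j ∷ p) (there l) = ≤-trans (∈⇒≤weight p l) (m≤n+m (weight p) (2 ^ j))

  -- Every element of `e m` is at most `m`, since `i` is below its summand `2 ^ i`; so filtering the
  -- numbers up to `m` lists the whole set.
  elements : ℕ → List ℕ
  elements m = filter (λ i → em {e m i}) (upTo (ℕ.suc m))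

  e⇒∈ : ∀ m {i} → e m i → i ∈ elements m
  e⇒∈ m h@(p , _ , refl , l) = ∈-filter⁺ (λ i → em {e m i}) (∈-upTo⁺ (s≤s (∈⇒≤weight p l))) h

  observe : ∀ (A B : Pred ℕ 0ℓ) {i} → (A ∘ₚ B) i → ∃₂ λ u v → All A u × All B v ×
            (∀ {A′ B′ Z : Pred ℕ 0ℓ} → All A′ u → All B′ v → A′ ∘ₚ B′ ≐ Z → Z i)
  observe A B {i} (m , a , sub) =
    ⟨ m , i ⟩ ∷ [] , elements m , a ∷ [] ,
    All-map sub (all-filter (λ i → em {e m i}) (upTo (ℕ.suc m))) ,
    λ { (a′ ∷ []) b′ (to , _) → to (m , a′ , λ l → All-lookup b′ (e⇒∈ m l)) }

applyUpTo-cong : ∀ {a} {A : Set a} {f g : ℕ → A} n → (∀ {i} → i < n → f i ≡ g i) →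
                 applyUpTo f n ≡ applyUpTo g n
applyUpTo-cong zero      h = refl
applyUpTo-cong (ℕ.suc n) h = cong₂ _∷_ (h (s≤s z≤n)) (applyUpTo-cong n (h ∘ s≤s))

module FunctionObservations
  {X : Set} (emb : X → ℕ) (emb-injective : ∀ {x y} → emb x ≡ emb y → x ≡ y)
  (Out : (ℕ → X) → X → Set)
  (Out-finitary : ∀ {q y} → Out q y → ∃ λ N → ∀ {q′ y′} → (∀ {j} → j < N → q′ j ≡ q j) →
                  Out q′ y′ → y′ ≡ y)
  where

  infix 4 _⊩_
  -- The graph of `α` passes through the point coded by `i`; these are the subbasic open sets of the
  -- product topology.
  _⊩_ : (ℕ → X) → ℕ → Set
  α ⊩ i = emb (α (proj₁ (unpair i))) ≡ proj₂ (unpair i)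

  graph : (ℕ → X) → ℕ → ℕ
  graph α n = ⟨ n , emb (α n) ⟩

  ⊩-graph : ∀ α n → α ⊩ graph α n
  ⊩-graph α n rewrite unpair-pair n (emb (α n)) = refl

  graph-⊩ : ∀ α β n → β ⊩ graph α n → β n ≡ α n
  graph-⊩ α β n h rewrite unpair-pair n (emb (α n)) = emb-injective h

  App : (ℕ → X) → (ℕ → X) → (ℕ → X) → Set
  App α β δ = ∀ n → Out (λ k → α (code (n ∷ applyUpTo (emb ∘ β) k))) (δ n)

  ⊩-resp : ∀ {α β} → α ≗ β → ∀ i → α ⊩ i → β ⊩ i
  ⊩-resp h i = trans (cong emb (sym (h _)))

  App-continuous : ∀ {α β δ i} → App α β δ → δ ⊩ i → ∃₂ λ u v → All (α ⊩_) u × All (β ⊩_) v ×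
    (∀ {α′ β′ δ′} → All (α′ ⊩_) u → All (β′ ⊩_) v → App α′ β′ δ′ → δ′ ⊩ i)
  App-continuous {α} {β} {δ} {i} h o with Out-finitary (h (proj₁ (unpair i)))
  ... | N , determined =
    -- The `j`-th question quotes the argument below `j` only. Hence agreement with `β` below `N`
    -- keeps the first `N` questions the same, and agreement with `α` at them keeps the answers.
    applyUpTo (graph α ∘ question) N , applyUpTo (graph β) N ,
    applyUpTo⁺₂ _ N (⊩-graph α ∘ question) , applyUpTo⁺₂ _ N (⊩-graph β) ,
    λ {α′} {β′} hα hβ h′ → trans (cong emb (determined (λ {j} l →
      trans (cong (λ w → α′ (code (proj₁ (unpair i) ∷ w))) (applyUpTo-cong j λ l′ →
               cong emb (graph-⊩ β β′ _ (applyUpTo⁻ (graph β) N hβ (<-trans l′ l)))))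
            (graph-⊩ α α′ (question j) (applyUpTo⁻ (graph α ∘ question) N hα l))) (h′ _))) o
    where
    question : ℕ → ℕ
    question k = code (proj₁ (unpair i) ∷ applyUpTo (emb ∘ β) k)

  distinct : ∀ {x y} → x ≢ y → ∃₂ λ α β → ¬ (∀ i → α ⊩ i → β ⊩ i)
  distinct {x} {y} x≢y = (λ _ → x) , (λ _ → y) , λ h →
    x≢y (sym (graph-⊩ (λ _ → x) (λ _ → y) 0 (h (graph (λ _ → x) 0) (⊩-graph (λ _ → x) 0))))

kleene-observations : Observations (PCA.pas 𝒦₂)
kleene-observations = record
  { _⊩_        = _⊩_
  ; ⊩-resp     = ⊩-resp
  ; continuous = λ {α} {β} {δ} {i} → App-continuous {α} {β} {δ} {i}
  ; distinct   = distinct {0} {1} λ ()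
  }
  where
  Out : (ℕ → ℕ) → ℕ → Set
  Out q y = ∃ λ k → q k ≡ ℕ.suc y × (∀ {j} → j < k → q j ≡ 0)

  finitary : ∀ {q y} → Out q y → ∃ λ N → ∀ {q′ y′} → (∀ {j} → j < N → q′ j ≡ q j) →
             Out q′ y′ → y′ ≡ y
  -- The answer at `k` carries the output, and the zeros before it keep any other run from stopping
  -- earlier.
  finitary {q} {y} (k , h , z) = ℕ.suc k , determined
    where
    determined : ∀ {q′ y′} → (∀ {j} → j < ℕ.suc k → q′ j ≡ q j) → Out q′ y′ → y′ ≡ y
    determined same (k′ , h′ , z′) with <-cmp k k′
    ... | tri< l _ _    = contradiction (trans (sym (z′ l)) (trans (same ≤-refl) h)) 0≢1+n
    ... | tri≈ _ refl _ = suc-injective (trans (sym h′) (trans (same ≤-refl) h))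
    ... | tri> _ _ l    = contradiction
      (trans (sym (z l)) (trans (sym (same (m≤n⇒m≤1+n l))) h′)) 0≢1+n

  open FunctionObservations id id Out finitary

cantor-observations : Observations (PCA.pas 2^ω)
cantor-observations = record
  { _⊩_        = _⊩_
  ; ⊩-resp     = ⊩-resp
  ; continuous = λ {α} {β} {δ} {i} → App-continuous {α} {β} {δ} {i}
  ; distinct   = distinct {0F} {1F} λ ()
  }
  where
  Out : (ℕ → Fin 2) → Fin 2 → Set
  Out q y = ∃ λ k → q k ≡ 1F × (∀ {j} → j < k → q j ≢ 1F) × y ≡ q (ℕ.suc k)

  finitary : ∀ {q y} → Out q y → ∃ λ N → ∀ {q′ y′} → (∀ {j} → j < N → q′ j ≡ q j) →
             Out q′ y′ → y′ ≡ y
  -- One answer more than for `𝒦₂`: the flag is at `k`, but the output is read at `k + 1`.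
  finitary {q} {y} (k , h , z , w) = 2 + k , determined
    where
    determined : ∀ {q′ y′} → (∀ {j} → j < 2 + k → q′ j ≡ q j) → Out q′ y′ → y′ ≡ y
    determined same (k′ , h′ , z′ , w′) with <-cmp k k′
    ... | tri< l _ _    = contradiction (trans (same (n≤1+n (1 + k))) h) (z′ l)
    ... | tri≈ _ refl _ = trans w′ (trans (same ≤-refl) (sym w))
    ... | tri> _ _ l    = contradiction
      (trans (sym (same (m≤n⇒m≤1+n (m≤n⇒m≤1+n l)))) h′) (z l)

  open FunctionObservations toℕ toℕ-injective Out finitary

observations : ExcludedMiddle 0ℓ → ∀ M → Observations (PCA.pas ⟦ M ⟧)
observations em scott  = scott-observations em
observations em kleene = kleene-observations
observations em cantor = cantor-observations

-- A copy of Cantor space in each model, and numbering of pairs of lists.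

sequence : ∀ M → (ℕ → Bool) → PCA.Carrier ⟦ M ⟧
sequence scott  a n = a n ≡ true
sequence kleene a n = if a n then 1 else 0
sequence cantor a n = if a n then 1F else 0F

sequence-injective : ∀ M {a b} → PCA._≈_ ⟦ M ⟧ (sequence M a) (sequence M b) → a ≗ b
sequence-injective scott {a} {b} (to , from) n with a n in p | b n in q
... | true  | true  = refl
... | false | false = refl
... | true  | false = trans (sym (to p)) q
... | false | true  = trans (sym p) (from q)
sequence-injective kleene {a} {b} h n with a n | b n | h n
... | true  | true  | _ = refl
... | false | false | _ = refl
sequence-injective cantor {a} {b} h n with a n | b n | h n
... | true  | true  | _ = refl
... | false | false | _ = refl

codes : List ℕ → List ℕ → ℕ
codes u v = ⟨ code u , code v ⟩

codes-injective : ∀ u u′ {v v′} → codes u v ≡ codes u′ v′ → u ≡ u′ × v ≡ v′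
codes-injective u u′ {v} {v′} h =
  let hu , hv = ,-injective (trans (sym (unpair-pair (code u) (code v)))
        (trans (cong unpair h) (unpair-pair (code u′) (code v′))))
  in code-injective hu , code-injective hv
  where
  code-injective : ∀ {w w′} → code w ≡ code w′ → w ≡ w′
  code-injective {w} {w′} h = trans (sym (decode-code w)) (trans (cong decode h) (decode-code w′))

-- Numbering the sequences by forcing information.

corollary3p6 : ExcludedMiddle (suc 0ℓ) →
    (M N : Model) →
    let A = PCA.pas ⟦ M ⟧
        B = PCA.pas ⟦ N ⟧ in
    (C : Codings A) (bA : Booleans (A [Eq] C)) (bB : Booleans B) {ℓ : Level}
    (γ : ApplicativeMorphism (A [Eq] C) B ℓ) →
    ¬ IsDecidable bA bB γ
corollary3p6 em₁ M N C bA bB γ (d , d-T , d-F) =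
  -- A sequence is numbered by the two lists of observations that force its test on itself to yield
  -- the observation separating `T` from `F`.
  cantor-diagonal em (λ a → codes (proj₁ (forced a)) (proj₁ (proj₂ (forced a)))) λ {a} {b} same →
    sequence-injective M (decidable-stable em
      (inseparable a b (codes-injective (proj₁ (forced a)) (proj₁ (forced b)) same)))
  where
  em : ExcludedMiddle 0ℓ
  em = lower-em em₁

  module B = PCA ⟦ N ⟧
  open B using (_⇓_)
  open Observations (observations em N)
  open ApplicativeMorphism γ renaming (γ to Γ)
  open EqualityTest ⟦ M ⟧ C (Booleans.T bA) (Booleans.F bA)

  ι : (ℕ → Bool) → PCA.Carrier ⟦ M ⟧
  ι = sequence M

  test : B.Carrier → B.Carrier → Term B.Carrier
  test t x = ` d ∙ (` r ∙ ` t ∙ ` x)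

  tester realizer : (ℕ → Bool) → B.Carrier
  tester a   = proj₁ (nonempty (χ (ι a)))
  realizer a = proj₁ (nonempty (ι a))

  test-T : ∀ a → test (tester a) (realizer a) ⇓ Booleans.T bB
  test-T a with r-law (χ-≈ (PCA.≈-refl ⟦ M ⟧)) (proj₂ (nonempty (χ (ι a)))) (proj₂ (nonempty (ι a)))
  ... | _ , h , g = ⇓-replaceʳ B.pas h (d-T g)

  test-F : ∀ a b → ¬ PCA._≈_ ⟦ M ⟧ (ι a) (ι b) → test (tester a) (realizer b) ⇓ Booleans.F bB
  test-F a b a≉b with r-law (χ-≉ a≉b) (proj₂ (nonempty (χ (ι a)))) (proj₂ (nonempty (ι b)))
  ... | _ , h , g = ⇓-replaceʳ B.pas h (d-F g)

  separated : ∃ λ i → Booleans.T bB ⊩ i × ¬ Booleans.F bB ⊩ i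
  separated = T-F-separated (observations em N) em bB

  forced : ∀ a → ∃₂ λ u v → tester a ⊩* u × realizer a ⊩* v ×
           (∀ {t x z} → t ⊩* u → x ⊩* v → test t x ⇓ z → z ⊩* (proj₁ separated ∷ []))
  forced a = ∙-continuous O (constant-continuous O d) (∙-continuous O (∙-continuous O
    (constant-continuous O r) (first-continuous O)) (second-continuous O))
    (test-T a) (proj₁ (proj₂ separated) ∷ [])
    where O = observations em N

  -- If `ι a` and `ι b` differed, testing `realizer b` with `tester a` would give `F`. But
  -- `realizer b` satisfies the list recorded for `b`, which is also the one recorded for `a`, so
  -- this value is forced to satisfy the separating observation.
  inseparable : ∀ a b →
    (proj₁ (forced a) ≡ proj₁ (forced b)) × (proj₁ (proj₂ (forced a)) ≡ proj₁ (proj₂ (forced b))) →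
    ¬ ¬ PCA._≈_ ⟦ M ⟧ (ι a) (ι b)
  inseparable a b (hu , hv) a≉b =
    let _ , _ , au , _ , forces = forced a
        _ , _ , _ , bv , _ = forced b
        _ , _ , F-unobserved = separated
    in F-unobserved (All-head (forces au (subst (realizer b ⊩*_) (sym hv) bv) (test-F a b a≉b)))
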